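{- Let $\ell,r\ge1$ be integers, let $p$ be a divisor of $r$ that does not divide $\ell$, and for every $q\mid p$ let $\Delta_q=\gcd(\ell,q)$. For the canonical negative-positive double Boolean automata circuit $D_{\ell,r}$ (negative left-circuit of size $\ell$, positive right-circuit of size $r$), the number of configurations of period $p$ is $$C_{p,\Delta_p}=L\!\left(\frac{p}{\Delta_p}\right)^{\Delta_p}.$$ Consequently, the number of attractors of period $p$ is $$\mathtt{A}_p^{\pm}(\ell,r)=\frac1p\sum_{q\mid p}\mu\!\left(\frac pq\right) L\!\left(\frac{q}{\Delta_q}\right)^{\Delta_q}.$$
   Context: The canonical negative-positive double Boolean automata circuit $D_{\ell,r}$ has $n=\ell+r-1$ nodes $0,\ldots,n-1$. For a configuration $x=(x_0,\ldots,x_{n-1})\in\{0,1\}^n$ write $x^L=(x_0,\ldots,x_{\ell-1})$ (states of the left-circuit) and $x^R=(x_0,x_\ell,\ldots,x_{n-1})$ (states of the right-circuit, $r$ entries). All nodes are updated in parallel by $F:\{0,1\}^n\to\{0,1\}^n$: $F(x)_i=x_{i-1}$ for $i\notin\{0,\ell\}$; $F(x)_\ell=x_0$ (if $r\ge2$); and $F(x)_0=\neg a\vee b$, where $a=x_{\ell-1}$ is the last entry of $x^L$ and $b$ is the last entry of $x^R$ (so $b=x_{n-1}$ when $r\ge 2$). A configuration $x$ has period $p$ if $F^{p}(x)=x$ ($p$ need not be minimal); it has exact period $p$ if moreover it has no period $d<p$, $d\geq 1$. An attractor of period $p$ is the orbit under $F$ of a configuration of exact period $p$. $\mu$ is the Möbius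 function. $L$ is the Lucas sequence: $L(1)=1$, $L(2)=3$, $L(m)=L(m-1)+L(m-2)$ for $m\ge3$; equivalently $L(m)=\phi^m+(-1/\phi)^m$ with $\phi=\frac{1+\sqrt5}{2}$. -}

module Defs where

open import Level using (Level; 0ℓ)
open import Algebra.Properties.Monoid.Sum using (sum-syntax)
open import Data.Bool.Base using (Bool; not; _∨_; if_then_else_)
open import Data.Fin.Base using (Fin; zero; suc; toℕ; inject₁)
open import Data.Integer.Base as ℤ using (ℤ; 0ℤ; -1ℤ)
import Data.Integer.Properties as ℤ
open import Data.List.Base using (length)
open import Data.List.Relation.Unary.Unique.DecPropositional using (unique?)
open import Data.Nat.Base
open import Data.Nat.Divisibility using (_∣?_)
open import Data.Nat.GCD using (gcd; gcd[m,n]≢0)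
open import Data.Nat.Primality.Factorisation using (factorise; factors)
open import Data.Nat.Properties using (_≟_)
open import Data.Product.Base using (∃; _×_; proj₁)
open import Data.Sum.Base using (inj₂)
open import Data.Vec.Base using (Vec; _∷_; head; tail; take; drop; last; lookup; tabulate)
import Function.Endo.Propositional as Endo
open import Function.Bundles using (Inverse)
open import Relation.Binary.Bundles using (Setoid)
import Relation.Binary.Construct.On as On
open import Relation.Binary.PropositionalEquality using (_≡_; setoid)
open import Relation.Nullary.Decidable using (does)
open import Relation.Nullary.Negation using (¬_)
open import Relation.Unary using (Pred; _≐_)
open import Relation.Unary.Relation.Binary.Equality using (≐-setoid)

private
  variable
    a e b : Level

-- L 0 = 2 is the usual backward extension: it makes L 2 = L 1 + L 0 = 3.
L : ℕ → ℕ
L zero          = 2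
L (suc zero)    = 1
L (suc (suc m)) = L (suc m) + L m

-- The value at 0 is junk.
μ : ℕ → ℤ
μ zero      = 0ℤ
μ n@(suc _) = if does (unique? _≟_ ps) then -1ℤ ℤ.^ length ps else 0ℤ
  where ps = factors (factorise n)

divisorSum : (p : ℕ) → ((q : ℕ) .{{_ : NonZero q}} → ℤ) → ℤ
divisorSum p f =
  sum-syntax ℤ.+-0-monoid p λ i →
    if does (suc (toℕ i) ∣? p) then f (suc (toℕ i)) else 0ℤ

gcd-nonZero : ∀ m n .{{_ : NonZero n}} → NonZero (gcd m n)
gcd-nonZero m n = ≢-nonZero (gcd[m,n]≢0 m n (inj₂ (≢-nonZero⁻¹ n)))

-- The elements of S satisfying P, counted up to the equality of S (so that
-- different proofs of P x do not give different elements), are k in number.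
HasSize : (S : Setoid a e) → Pred (Setoid.Carrier S) b → ℕ → Set _
HasSize S P k = Inverse (On.setoid {B = ∃ P} S proj₁) (setoid (Fin k))

module DoubleCircuit (ℓ r : ℕ) .{{_ : NonZero ℓ}} .{{_ : NonZero r}} where

  -- suc (pred ℓ + pred r) is ℓ + r - 1, in a form that exhibits node 0.
  Config : Set
  Config = Vec Bool (suc (pred ℓ + pred r))

  leftStates : Config → Vec Bool (suc (pred ℓ))
  leftStates x = head x ∷ take (pred ℓ) (tail x)

  rightStates : Config → Vec Bool (suc (pred r))
  rightStates x = head x ∷ drop (pred ℓ) (tail x)

  F : Config → Config
  F x = tabulate next
    where
    next : Fin (suc (pred ℓ + pred r)) → Bool
    next zero    = not (last (leftStates x)) ∨ last (rightStates x)
    next (suc i) = if suc (toℕ i) ≡ᵇ ℓ then head x else lookup x (inject₁ i)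

  open Endo Config using () renaming (_^_ to iterate)

  HasPeriod : ℕ → Pred Config 0ℓ
  HasPeriod p x = iterate F p x ≡ x

  HasExactPeriod : ℕ → Pred Config 0ℓ
  HasExactPeriod p x =
    HasPeriod p x × (∀ d → 1 ≤ d → d < p → ¬ HasPeriod d x)

  Orbit : Config → Pred Config 0ℓ
  Orbit x y = ∃ λ k → iterate F k x ≡ y

  IsAttractor : ℕ → Pred (Pred Config 0ℓ) 0ℓ
  IsAttractor p A = ∃ λ x → HasExactPeriod p x × A ≐ Orbit x

  NumberOfConfigsOfPeriod : ℕ → ℕ → Set
  NumberOfConfigsOfPeriod p = HasSize (setoid Config) (HasPeriod p)

  NumberOfAttractorsOfPeriod : ℕ → ℕ → Set _
  NumberOfAttractorsOfPeriod p = HasSize (≐-setoid Config 0ℓ) (IsAttractor p)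

{-# OPTIONS --safe #-}
module Submission where

-- Let σ t be the state of node 0 at time t.  Since p ∣ r, the trajectories of period p satisfy
-- σ t = ¬ σ (t - ℓ) ∨ σ t, that is σ t ∨ σ (t - ℓ): no two zeros at distance ℓ on the cycle ℤ/p.
-- Translation by ℓ splits ℤ/p into Δ = gcd ℓ p cycles of length m = p/Δ, and a cycle of length m
-- carries tr ((0 1; 1 1)ᵐ) = L m binary labellings without adjacent zeros.
-- The periods of a configuration of period p are the multiples of its least period d, so Möbius
-- inversion amounts to Σ μ (p/q) over d ∣ q ∣ p being 1 if d = p and 0 otherwise; and each
-- attractor consists of p configurations.

open import Defs
open import Level using (Level; _⊔_; 0ℓ)
open import Data.Bool.Base using (Bool; true; false; not; _∨_; if_then_else_)
open import Data.Bool.Properties using (∨-comm) renaming (_≟_ to _≟ᵇ_)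
open import Data.Fin.Base using (Fin; zero; suc; toℕ; fromℕ<; inject₁; splitAt; join; remQuot; combine; finToFun; funToFin)
open import Data.Fin.Properties using (injective⇒≤; splitAt-join; join-splitAt; any?; toℕ-fromℕ<; toℕ-injective; toℕ<n; toℕ-inject₁; suc-injective; remQuot-combine; combine-remQuot; funToFin-finToFin; finToFun-funToFin)
open import Data.Integer.Base as ℤ using (ℤ; +_; 0ℤ; 1ℤ; -1ℤ)
import Data.Integer.Properties as ℤ
open import Data.List.Base using ([]; _∷_; length)
open import Data.List.Membership.Propositional using (_∈_)
open import Data.List.Relation.Binary.Permutation.Propositional using (_↭_; ↭-sym; ↭⇒↭ₛ)
open import Data.List.Relation.Binary.Permutation.Propositional.Properties using (↭-length)
import Data.List.Relation.Binary.Permutation.Setoid.Properties as ↭ₛ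
open import Data.List.Relation.Unary.All using (All; []; _∷_)
open import Data.List.Relation.Unary.All.Properties using (¬Any⇒All¬; All¬⇒¬Any)
open import Data.List.Relation.Unary.AllPairs using (_∷_; tail)
open import Data.List.Relation.Unary.Unique.Propositional using (Unique)
open import Data.Nat.Base as ℕ using (ℕ; zero; suc; _+_; _*_; _∸_; _^_; _≤_; _<_; _≡ᵇ_; NonZero; >-nonZero; z≤n; s≤s)
import Data.Nat.Properties as ℕ
open import Data.List.Relation.Unary.Unique.DecPropositional ℕ._≟_ using (unique?)
open import Data.Nat.Coprimality using (Coprime; coprime-divisor; coprime-Bézout; coprime-/gcd)
open import Data.Nat.DivMod using (_/_; _%_; _mod_; m≡m%n+[m/n]*n; m%n<n; m<n⇒m%n≡m; [m+n]%n≡m%n; [m+kn]%n≡m%n; n%n≡0; +-distrib-/-∣ʳ; m*n/n≡m; m<n⇒m/n≡0; m/n*n≡m; m≥n⇒m/n>0)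
open import Data.Nat.Divisibility using (_∣_; _∤_; _∣?_; divides; ∣⇒≤; ∣-trans; ∣1⇒≡1; *-cancelˡ-∣; *-monoʳ-∣; m∣m*n; n∣m*n; m%n≡0⇒n∣m)
open import Data.Nat.GCD using (gcd; gcd[m,n]∣m; gcd[m,n]∣n; module Bézout)
open import Data.Nat.Induction using (<-rec)
open import Data.Nat.ListAction using (product)
open import Data.Nat.ListAction.Properties using (∈⇒∣product)
open import Data.Nat.Primality using (Prime; prime⇒irreducible; prime⇒nonZero)
open import Data.Nat.Primality.Factorisation using (PrimeFactorisation; factors; factorise; factorisationUnique; factorisationHasAllPrimeFactors)
open import Data.Nat.Tactic.RingSolver using (solve-∀)
open import Data.Product.Base using (∃; ∃₂; _×_; _,_; proj₁; proj₂; uncurry)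
open import Data.Rational.Base as ℚ using (toℚᵘ)
import Data.Rational.Properties as ℚ
open import Data.Rational.Unnormalised.Base as ℚᵘ using (*≡*)
import Data.Rational.Unnormalised.Properties as ℚᵘ
open import Data.Sum.Base using (_⊎_; inj₁; inj₂; [_,_])
open import Data.Unit.Base using (⊤)
open import Data.Vec.Base using (Vec; []; _∷_; _++_; tabulate; lookup; head; last; take; drop)
open import Data.Vec.Properties using (tabulate-cong; lookup∘tabulate; take++drop≡id; ++-injective; ∷-injective; ∷-injectiveʳ; ≡-dec)
open import Function.Base using (_∘_; id)
open import Function.Bundles using (mk⇔)
import Function.Endo.Propositional as Endo
open import Relation.Binary.Bundles using (Setoid)
open import Relation.Binary.Core using (REL)
import Relation.Binary.Definitions as B
open import Relation.Binary.PropositionalEquality using (_≡_; _≢_; _≗_; refl; sym; trans; cong; cong₂; cong-app; subst; subst₂; setoid; _→-setoid_; module ≡-Reasoning)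
open import Relation.Nullary.Decidable using (Dec; does; yes; no; does-⇔; dec-true; dec-false; map′; _×-dec_; _→-dec_; ¬?)
open import Relation.Nullary.Negation using (¬_; contradiction)
open import Relation.Unary using (Pred; Decidable; _∪_; _≐_)
open import Relation.Unary.Properties using (≐-refl; ≐-sym; ≐-trans)
open import Relation.Unary.Relation.Binary.Equality using (≐-setoid)
open import Algebra.Properties.CommutativeMonoid.Sum ℤ.+-0-commutativeMonoid using (∑-comm; ∑-distrib-+)
open import Algebra.Properties.Monoid.Sum ℤ.+-0-monoid using (sum; sum-cong-≗; sum-replicate-zero)
open import Algebra.Properties.Semiring.Sum ℤ.+-*-semiring using (*-distribˡ-sum)

private
  variable
    a b c e e′ : Level
    j k k′ m n : ℕ

record Enumeration (S : Setoid a e) (P : Pred (Setoid.Carrier S) b) (k : ℕ) :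
                   Set (a ⊔ e ⊔ b) where
  open Setoid S
  field
    element   : Fin k → Carrier
    sound     : ∀ i → P (element i)
    injective : ∀ {i j} → element i ≈ element j → i ≡ j
    complete  : ∀ {x} → P x → ∃ λ i → element i ≈ x

open Enumeration

hasSize : {S : Setoid a e} {P : Pred (Setoid.Carrier S) b} →
          Enumeration S P k → HasSize S P k
hasSize {S = S} E = record
  { to        = λ (_ , Px) → proj₁ (complete E Px)
  ; from      = λ i → element E i , sound E i
  ; to-cong   = λ {(_ , Px)} {(_ , Py)} x≈y → injective E
      (S.trans (proj₂ (complete E Px)) (S.trans x≈y (S.sym (proj₂ (complete E Py)))))
  ; from-cong = λ where refl → S.refl
  ; inverse   = (λ {_} {(_ , Py)} y≈i → injective E (S.trans (proj₂ (complete E Py)) y≈i))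
              , (λ {(_ , Px)} → λ where refl → proj₂ (complete E Px))
  }
  where module S = Setoid S

size-≤ : {S : Setoid a e} {P : Pred (Setoid.Carrier S) b} →
         Enumeration S P j → Enumeration S P k → j ≤ k
size-≤ {S = S} D E = injective⇒≤ {f = index} λ {i} {i′} eq → injective D
  (S.trans (S.sym (matches i)) (S.trans (S.reflexive (cong (element E) eq)) (matches i′)))
  where
  module S = Setoid S
  index = λ i → proj₁ (complete E (sound D i))
  matches = λ i → proj₂ (complete E (sound D i))

size-unique : {S : Setoid a e} {P : Pred (Setoid.Carrier S) b} →
              Enumeration S P j → Enumeration S P k → j ≡ k
size-unique D E = ℕ.≤-antisym (size-≤ D E) (size-≤ E D)

transport : {S : Setoid a e} {P : Pred (Setoid.Carrier S) b}
            {T : Setoid c e′} {Q : Pred (Setoid.Carrier T) b} →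
            let module S = Setoid S
                module T = Setoid T in
            (f : S.Carrier → T.Carrier) →
            (∀ {x y} → x S.≈ y → f x T.≈ f y) →
            (∀ {x} → P x → Q (f x)) →
            (∀ {x y} → P x → P y → f x T.≈ f y → x S.≈ y) →
            (∀ {y} → Q y → ∃ λ x → P x × f x T.≈ y) →
            Enumeration S P k → Enumeration T Q k
transport {T = T} f f-cong f-sound f-inj f-surj E = record
  { element   = f ∘ element E
  ; sound     = f-sound ∘ sound E
  ; injective = injective E ∘ f-inj (sound E _) (sound E _)
  ; complete  = λ Qy → let x , Px , fx≈y = f-surj Qy
                           i , i≈x = complete E Px
                       in i , Setoid.trans T (f-cong i≈x) fx≈y
  }

respects-⇔ : {S : Setoid a e} {P : Pred (Setoid.Carrier S) b} {Q : Pred (Setoid.Carrier S) c} →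
             (∀ {x} → P x → Q x) → (∀ {x} → Q x → P x) →
             Enumeration S P k → Enumeration S Q k
respects-⇔ P⇒Q Q⇒P E = record
  { element   = element E
  ; sound     = P⇒Q ∘ sound E
  ; injective = injective E
  ; complete  = complete E ∘ Q⇒P
  }

empty : {S : Setoid a e} {P : Pred (Setoid.Carrier S) b} → (∀ {x} → ¬ P x) → Enumeration S P 0
empty ¬P = record
  { element   = λ ()
  ; sound     = λ ()
  ; injective = λ {i} → contradiction i λ ()
  ; complete  = λ Px → contradiction Px ¬P
  }

singleton : (S : Setoid a e) → let open Setoid S in (x : Carrier) → Enumeration S (x ≈_) 1
singleton S x = record
  { element   = λ _ → x
  ; sound     = λ _ → Setoid.refl S
  ; injective = λ { {zero} {zero} _ → refl }
  ; complete  = λ x≈y → zero , x≈y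
  }

union : {S : Setoid a e} {P : Pred (Setoid.Carrier S) b} {Q : Pred (Setoid.Carrier S) c} →
        (∀ {x y} → P x → Q y → ¬ Setoid._≈_ S x y) →
        Enumeration S P j → Enumeration S Q k → Enumeration S (P ∪ Q) (j + k)
union {j = j} {k = k} {S = S} {P} {Q} P#Q D E = record
  { element   = el ∘ splitAt j
  ; sound     = λ i → el-sound (splitAt j i)
  ; injective = λ {i} {i′} eq → trans (sym (join-splitAt j k i))
      (trans (cong (join j k) (el-inj (splitAt j i) (splitAt j i′) eq)) (join-splitAt j k i′))
  ; complete  = λ PQx → let i , eq = el-complete PQx in
      join j k i , subst (λ z → el z ≈ _) (sym (splitAt-join j k i)) eq
  }
  where
  open Setoid S using (_≈_)
  el : Fin j ⊎ Fin k → Setoid.Carrier S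
  el = [ element D , element E ]
  el-sound : ∀ i → (P ∪ Q) (el i)
  el-sound (inj₁ i) = inj₁ (sound D i)
  el-sound (inj₂ i) = inj₂ (sound E i)
  el-inj : ∀ i i′ → el i ≈ el i′ → i ≡ i′
  el-inj (inj₁ i) (inj₁ i′) eq = cong inj₁ (injective D eq)
  el-inj (inj₁ i) (inj₂ i′) eq = contradiction eq (P#Q (sound D i) (sound E i′))
  el-inj (inj₂ i) (inj₁ i′) eq = contradiction (Setoid.sym S eq) (P#Q (sound D i′) (sound E i))
  el-inj (inj₂ i) (inj₂ i′) eq = cong inj₂ (injective E eq)
  el-complete : ∀ {x} → (P ∪ Q) x → ∃ λ i → el i ≈ x
  el-complete (inj₁ Px) = let i , eq = complete D Px in inj₁ i , eq
  el-complete (inj₂ Qx) = let i , eq = complete E Qx in inj₂ i , eq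

image : (S : Setoid a e) → let open Setoid S in
        (f : Fin k → Carrier) → (∀ i j → Dec (f i ≈ f j)) →
        ∃ λ m → Enumeration S (λ x → ∃ λ i → f i ≈ x) m
image {k = 0}     S f f≈f? = 0 , empty λ ()
image {k = suc k} S f f≈f? with image S (f ∘ suc) (λ i j → f≈f? (suc i) (suc j))
                              | any? (λ i → f≈f? (suc i) zero)
... | m , E | yes (j , fj≈f0) = m , respects-⇔ (λ (i , eq) → suc i , eq)
  (λ where (zero  , eq) → j , Setoid.trans S fj≈f0 eq
           (suc i , eq) → i , eq) E
... | m , E | no f0∉ = suc m , respects-⇔
  (λ where (inj₁ eq)       → zero , eq
           (inj₂ (i , eq)) → suc i , eq)
  (λ where (zero  , eq) → inj₁ eq
           (suc i , eq) → inj₂ (i , eq))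
  (union (λ f0≈x (i , fi≈y) x≈y → f0∉ (i , S.trans fi≈y (S.sym (S.trans f0≈x x≈y))))
         (singleton S (f zero)) E)
  where module S = Setoid S

guard : {A : Set a} → Dec A → ℤ → ℤ
guard d x = if does d then x else 0ℤ

subset-Fin : ∀ {n} {P : Pred (Fin n) 0ℓ} (P? : Decidable P) →
             ∃ λ k → Enumeration (setoid (Fin n)) P k × + k ≡ sum (λ i → guard (P? i) 1ℤ)
subset-Fin {0}     P? = 0 , empty (λ {i} → contradiction i λ ()) , refl
subset-Fin {suc n} {P} P? with subset-Fin (P? ∘ suc) | P? zero
... | k , E , eq | no ¬P0 = k , transport suc (cong suc) id (λ _ _ → λ where refl → refl)
    (λ { {zero}  P0 → contradiction P0 ¬P0
       ; {suc i} Pi → i , Pi , refl }) E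
  , trans eq (sym (ℤ.+-identityˡ _))
... | k , E , eq | yes P0 = suc k , respects-⇔
    (λ where (inj₁ refl)            → P0
             (inj₂ (_ , Pi , refl)) → Pi)
    (λ { {zero}  _  → inj₁ refl
       ; {suc i} Pi → inj₂ (i , Pi , refl) })
    (union (λ where refl (_ , _ , refl) ())
      (singleton (setoid (Fin (suc n))) zero)
      (transport {Q = λ j → ∃ λ i → P (suc i) × suc i ≡ j} suc (cong suc) (λ Pi → _ , Pi , refl)
        (λ _ _ → λ where refl → refl) id E))
  , cong ℤ.suc eq

subset : ∀ {A : Set} {n} {All : Pred A 0ℓ} → (∀ x → All x) →
         (E : Enumeration (setoid A) All n) →
         {P : Pred A 0ℓ} (P? : Decidable P) →
         ∃ λ k → Enumeration (setoid A) P k × + k ≡ sum (λ i → guard (P? (element E i)) 1ℤ)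
subset all E {P} P? = let k , D , eq = subset-Fin (P? ∘ element E) in
  k , transport (element E) (cong (element E)) id (λ _ _ → injective E)
    (λ {y} Py → let i , eq = complete E (all y) in i , subst P (sym eq) Py , eq) D , eq

-- Möbius sums

guard-yes : {A : Set a} (d : Dec A) {x : ℤ} → A → guard d x ≡ x
guard-yes d {x} h = cong (λ b → if b then x else 0ℤ) (dec-true d h)

guard-no : {A : Set a} (d : Dec A) {x : ℤ} → ¬ A → guard d x ≡ 0ℤ
guard-no d {x} h = cong (λ b → if b then x else 0ℤ) (dec-false d h)

guard-cong : {A : Set a} (d : Dec A) {x y : ℤ} → (A → x ≡ y) → guard d x ≡ guard d y
guard-cong (yes h) eq = eq h
guard-cong (no _)  _  = refl

guard-zero : {A : Set a} (d : Dec A) → guard d 0ℤ ≡ 0ℤ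
guard-zero (yes _) = refl
guard-zero (no _)  = refl

guard-⇔ : {A : Set a} {B : Set e} (d : Dec A) (d′ : Dec B) {x : ℤ} →
          (A → B) → (B → A) → guard d x ≡ guard d′ x
guard-⇔ d d′ {x} A⇒B B⇒A = cong (λ b → if b then x else 0ℤ) (does-⇔ (mk⇔ A⇒B B⇒A) d d′)

sum-zero : {f : Fin n → ℤ} → (∀ i → f i ≡ 0ℤ) → sum f ≡ 0ℤ
sum-zero {n} f≡0 = trans (sum-cong-≗ f≡0) (sum-replicate-zero n)

sum-single : {f : Fin n → ℤ} (k : Fin n) → (∀ i → i ≢ k → f i ≡ 0ℤ) → sum f ≡ f k
sum-single {f = f} zero f≡0 =
  trans (cong (ℤ._+_ (f zero)) (sum-zero λ i → f≡0 (suc i) λ ())) (ℤ.+-identityʳ _)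
sum-single {f = f} (suc k) f≡0 =
  trans (cong₂ ℤ._+_ (f≡0 zero λ ()) (sum-single k λ i i≢k → f≡0 (suc i) (i≢k ∘ suc-injective)))
        (ℤ.+-identityˡ _)

sum-match : {f : Fin m → ℤ} {g : Fin n → ℤ} (R : REL (Fin m) (Fin n) 0ℓ) → B.Decidable R →
            (∀ {i j j′} → R i j → R i j′ → j ≡ j′) →
            (∀ {i i′ j} → R i j → R i′ j → i ≡ i′) →
            (∀ {i j} → R i j → f i ≡ g j) →
            (∀ i → f i ≡ 0ℤ ⊎ ∃ λ j → R i j) →
            (∀ j → g j ≡ 0ℤ ⊎ ∃ λ i → R i j) →
            sum f ≡ sum g
sum-match {f = f} {g} R R? fun inj eq tot sur = begin
  sum f                                      ≡⟨ sum-cong-≗ row ⟩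
  sum (λ i → sum λ j → guard (R? i j) (f i)) ≡⟨ ∑-comm (λ i j → guard (R? i j) (f i)) ⟩
  sum (λ j → sum λ i → guard (R? i j) (f i)) ≡⟨ sum-cong-≗ column ⟩
  sum g                                      ∎
  where
  open ≡-Reasoning
  row : ∀ i → f i ≡ sum λ j → guard (R? i j) (f i)
  row i with tot i
  ... | inj₂ (j , Rij) = trans (sym (guard-yes (R? i j) Rij))
    (sym (sum-single j λ j′ j′≢j → guard-no (R? i j′) λ Rij′ → j′≢j (fun Rij′ Rij)))
  ... | inj₁ fi≡0 = trans fi≡0 (sym (sum-zero λ j →
    trans (guard-cong (R? i j) λ _ → fi≡0) (guard-zero (R? i j))))
  column : ∀ j → (sum λ i → guard (R? i j) (f i)) ≡ g j
  column j with sur j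
  ... | inj₂ (i , Rij) = trans
    (sum-single i λ i′ i′≢i → guard-no (R? i′ j) λ Ri′j → i′≢i (inj Ri′j Rij))
    (trans (guard-yes (R? i j) Rij) (eq Rij))
  ... | inj₁ gj≡0 = trans (sum-zero λ i → vanish i (R? i j)) (sym gj≡0)
    where
    vanish : ∀ i → (d : Dec (R i j)) → guard d (f i) ≡ 0ℤ
    vanish i (yes Rij) = trans (eq Rij) gj≡0
    vanish i (no _)    = refl

μ-factorisation : ∀ n .{{_ : NonZero n}} (F : PrimeFactorisation n) →
                  μ n ≡ guard (unique? (factors F)) (-1ℤ ℤ.^ length (factors F))
μ-factorisation n@(suc _) F = cong₂ (λ b k → if b then -1ℤ ℤ.^ k else 0ℤ)
  (does-⇔ (mk⇔ (resp ps↭qs) (resp (↭-sym ps↭qs))) (unique? _) (unique? _)) (↭-length ps↭qs)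
  where
  ps↭qs = factorisationUnique (factorise n) F
  resp : ∀ {ps qs} → ps ↭ qs → Unique ps → Unique qs
  resp = ↭ₛ.Unique-resp-↭ (setoid ℕ) ∘ ↭⇒↭ₛ

module _ {π : ℕ} (π-prime : Prime π) (n : ℕ) .{{_ : NonZero n}} where

  private
    ps = factors (factorise n)

    open PrimeFactorisation (factorise n) using (isFactorisation; factorsPrime)

    instance
      πn-nonZero : NonZero (π * n)
      πn-nonZero = ℕ.m*n≢0 π n {{prime⇒nonZero π-prime}}

    π∷ps : PrimeFactorisation (π * n)
    π∷ps = record
      { factors         = π ∷ ps
      ; isFactorisation = cong (π *_) isFactorisation
      ; factorsPrime    = π-prime ∷ factorsPrime
      }

    ∣⇒∈ : π ∣ n → π ∈ ps
    ∣⇒∈ π∣n = factorisationHasAllPrimeFactors π-prime (subst (π ∣_) isFactorisation π∣n) factorsPrime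

  μ-square : π ∣ n → μ (π * n) ≡ 0ℤ
  μ-square π∣n = trans (μ-factorisation (π * n) π∷ps)
    (guard-no (unique? (π ∷ ps)) λ where (π∉ps ∷ _) → All¬⇒¬Any π∉ps (∣⇒∈ π∣n))

  μ-prime-* : π ∤ n → μ (π * n) ≡ ℤ.- μ n
  μ-prime-* π∤n = begin
    μ (π * n)                                            ≡⟨ μ-factorisation (π * n) π∷ps ⟩
    guard (unique? (π ∷ ps)) (-1ℤ ℤ.* -1ℤ ℤ.^ length ps) ≡⟨ guard-⇔ (unique? (π ∷ ps)) (unique? ps)
      tail (¬Any⇒All¬ ps π∉ps ∷_) ⟩
    guard (unique? ps) (-1ℤ ℤ.* -1ℤ ℤ.^ length ps)       ≡⟨ neg (unique? ps) ⟩
    ℤ.- guard (unique? ps) (-1ℤ ℤ.^ length ps)           ≡⟨ cong ℤ.-_ (μ-factorisation n (factorise n)) ⟨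
    ℤ.- μ n                                              ∎
    where
    open ≡-Reasoning
    π∉ps : ¬ (π ∈ ps)
    π∉ps π∈ps = π∤n (subst (π ∣_) (sym isFactorisation) (∈⇒∣product π∈ps))
    neg : {A : Set a} (d : Dec A) {x : ℤ} → guard d (-1ℤ ℤ.* x) ≡ ℤ.- guard d x
    neg (yes _) {x} = ℤ.-1*i≡-i x
    neg (no _)  = refl

prime-divisor : ∀ n .{{_ : NonZero n}} → n ≢ 1 → ∃ λ π → Prime π × π ∣ n
prime-divisor n n≢1 with factorise n
... | record { factors = [] ; isFactorisation = eq } = contradiction eq n≢1
... | record { factors = π ∷ ps ; isFactorisation = eq ; factorsPrime = pr ∷ _ } =
  π , pr , subst (π ∣_) (sym eq) (m∣m*n (product ps))

∤-divisor : ∀ {π m n} → Prime π → π ∤ m → m ∣ π * n → m ∣ n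
∤-divisor {π} {m} pr π∤m = coprime-divisor coprime
  where
  coprime : Coprime m π
  coprime (d∣m , d∣π) with prime⇒irreducible pr d∣π
  ... | inj₁ d≡1  = d≡1
  ... | inj₂ refl = contradiction d∣m π∤m

below : ∀ {q N} → .{{NonZero q}} → q ≤ N → ∃ λ (i : Fin N) → suc (toℕ i) ≡ q
below {suc q} q<N = fromℕ< q<N , cong suc (toℕ-fromℕ< q<N)

suc∘toℕ-injective : {i j : Fin n} → suc (toℕ i) ≡ suc (toℕ j) → i ≡ j
suc∘toℕ-injective = toℕ-injective ∘ ℕ.suc-injective

∑μ : (N n : ℕ) → ℤ
∑μ N n = sum {N} λ i → guard (suc (toℕ i) ∣? n) (μ (suc (toℕ i)))

-- The divisors e prime to π cancel against their multiples π e; the multiples of π² contribute 0.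
μ-sum-prime : ∀ {π N} m .{{_ : NonZero m}} → Prime π → π * m ≤ N → ∑μ N (π * m) ≡ 0ℤ
μ-sum-prime {π} {N} m pr πm≤N = begin
  sum (λ i → h (v i))                         ≡⟨ sum-cong-≗ (λ i → split (v i)) ⟩
  sum (λ i → without (v i) ℤ.+ with′ (v i))   ≡⟨ ∑-distrib-+ {N} (without ∘ v) (with′ ∘ v) ⟩
  sum (without ∘ v) ℤ.+ sum (with′ ∘ v)       ≡⟨ cong (ℤ._+_ (sum (without ∘ v))) shift ⟩
  sum (without ∘ v) ℤ.+ sum (shifted ∘ v)     ≡⟨ ∑-distrib-+ {N} (without ∘ v) (shifted ∘ v) ⟨
  sum (λ i → without (v i) ℤ.+ shifted (v i)) ≡⟨ sum-zero (λ i → cancel (v i)) ⟩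
  0ℤ                                          ∎
  where
  open ≡-Reasoning
  instance
    π-nonZero = prime⇒nonZero pr
    πm-nonZero = ℕ.m*n≢0 π m
  v : Fin N → ℕ
  v i = suc (toℕ i)
  h without with′ shifted : ℕ → ℤ
  h e = guard (e ∣? π * m) (μ e)
  without e = if does (π ∣? e) then 0ℤ else h e
  with′ e = guard (π ∣? e) (h e)
  shifted e = guard (e ∣? m) (μ (π * e))
  split : ∀ e → h e ≡ without e ℤ.+ with′ e
  split e with π ∣? e
  ... | yes _ = sym (ℤ.+-identityˡ (h e))
  ... | no _  = sym (ℤ.+-identityʳ (h e))
  cancel : ∀ e .{{_ : NonZero e}} → without e ℤ.+ shifted e ≡ 0ℤ
  cancel e with π ∣? e
  ... | yes π∣e = trans (ℤ.+-identityˡ (shifted e))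
    (trans (guard-cong (e ∣? m) λ _ → μ-square pr e π∣e) (guard-zero (e ∣? m)))
  ... | no π∤e with e ∣? m
  ...   | yes e∣m = trans (cong₂ ℤ._+_ (guard-yes (e ∣? π * m) (∣-trans e∣m (n∣m*n π)))
                                       (μ-prime-* pr e π∤e)) (ℤ.+-inverseʳ (μ e))
  ...   | no e∤m  = trans (ℤ.+-identityʳ (h e)) (guard-no (e ∣? π * m) (e∤m ∘ ∤-divisor pr π∤e))
  shift : sum (with′ ∘ v) ≡ sum (shifted ∘ v)
  shift = sum-match (λ i j → v i ≡ π * v j) (λ i j → v i ℕ.≟ π * v j)
    (λ {_} {j} {j′} p q → suc∘toℕ-injective (ℕ.*-cancelˡ-≡ (v j) (v j′) π (trans (sym p) q)))
    (λ p q → suc∘toℕ-injective (trans p (sym q)))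
    (λ {i} {j} p → subst (λ z → with′ z ≡ shifted (v j)) (sym p) (same (v j)))
    (λ i → onto (v i) (π ∣? v i) (v i ∣? π * m) (toℕ<n i))
    (λ j → back (v j) (v j ∣? m))
    where
    same : ∀ e → with′ (π * e) ≡ shifted e
    same e = trans (guard-yes (π ∣? π * e) (m∣m*n e))
      (guard-⇔ (π * e ∣? π * m) (e ∣? m) (*-cancelˡ-∣ π) (*-monoʳ-∣ π))
    onto : ∀ e .{{_ : NonZero e}} (d : Dec (π ∣ e)) (d′ : Dec (e ∣ π * m)) → e ≤ N →
           guard d (guard d′ (μ e)) ≡ 0ℤ ⊎ ∃ λ j → e ≡ π * v j
    onto e (yes (divides k eq)) d′ e≤N =
      let instance k-nonZero = ℕ.m*n≢0⇒m≢0 k {{ℕ.≢-nonZero (subst (_≢ 0) eq (ℕ.≢-nonZero⁻¹ e))}}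
          eq′ = trans eq (ℕ.*-comm k π)
          j , vj≡k = below (ℕ.≤-trans (ℕ.m≤n*m k π) (subst (_≤ N) eq′ e≤N))
      in inj₂ (j , trans eq′ (cong (π *_) (sym vj≡k)))
    onto e (no _) d′ _ = inj₁ refl
    back : ∀ e .{{_ : NonZero e}} (d : Dec (e ∣ m)) →
           guard d (μ (π * e)) ≡ 0ℤ ⊎ ∃ λ i → v i ≡ π * e
    back e (yes e∣m) = inj₂ (below {{ℕ.m*n≢0 π e}} (ℕ.≤-trans (ℕ.*-monoʳ-≤ π (∣⇒≤ e∣m)) πm≤N))
    back e (no _)    = inj₁ refl

μ-sum : ∀ {n N} .{{_ : NonZero n}} → n ≤ N → ∑μ N n ≡ guard (n ℕ.≟ 1) 1ℤ
μ-sum {n} {N} n≤N with n ℕ.≟ 1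
μ-sum {n} {suc N} n≤N | yes refl =
  sum-single {suc N} {λ i → guard (suc (toℕ i) ∣? 1) (μ (suc (toℕ i)))} zero
    λ i i≢0 → guard-no (suc (toℕ i) ∣? 1)
      λ d → i≢0 (toℕ-injective (ℕ.suc-injective (∣1⇒≡1 d)))
... | no n≢1 with prime-divisor n n≢1
...   | π , pr , divides m eq = begin
  ∑μ N n             ≡⟨ cong (∑μ N) eq′ ⟩
  ∑μ N (π * m)       ≡⟨ μ-sum-prime m {{m≢0}} pr (subst (_≤ N) eq′ n≤N) ⟩
  0ℤ                 ≡⟨ guard-no (n ℕ.≟ 1) n≢1 ⟨
  guard (n ℕ.≟ 1) 1ℤ ∎
  where
  open ≡-Reasoning
  eq′ = trans eq (ℕ.*-comm m π)
  m≢0 = ℕ.m*n≢0⇒m≢0 m {{ℕ.≢-nonZero (subst (_≢ 0) eq (ℕ.≢-nonZero⁻¹ n))}}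

μ-interval-sum : ∀ {d p} .{{_ : NonZero p}} → d ∣ p →
                 divisorSum p (λ q → μ (p / q) ℤ.* guard (d ∣? q) 1ℤ) ≡ guard (d ℕ.≟ p) 1ℤ
μ-interval-sum {d} {p} d∣p@(divides n p≡nd) = begin
  sum (λ i → f (v i)) ≡⟨ sum-match (λ i j → v i * v j ≡ p) (λ i j → v i * v j ℕ.≟ p)
    (λ {i} {j} {j′} s t → suc∘toℕ-injective (ℕ.*-cancelˡ-≡ (v j) (v j′) (v i) (trans s (sym t))))
    (λ {i} {i′} {j} s t → suc∘toℕ-injective (ℕ.*-cancelʳ-≡ (v i) (v i′) (v j) (trans s (sym t))))
    (λ {i} {j} → same (v i) (v j))
    (λ i → onto (v i) (v i ∣? p))
    (λ j → back (v j) (v j ∣? n)) ⟩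
  ∑μ p n             ≡⟨ μ-sum (∣⇒≤ n∣p) ⟩
  guard (n ℕ.≟ 1) 1ℤ ≡⟨ guard-⇔ (n ℕ.≟ 1) (d ℕ.≟ p) n≡1⇒d≡p d≡p⇒n≡1 ⟩
  guard (d ℕ.≟ p) 1ℤ ∎
  where
  open ≡-Reasoning
  n∣p : n ∣ p
  n∣p = divides d (trans p≡nd (ℕ.*-comm n d))
  p≢0 : n * d ≢ 0
  p≢0 = subst (_≢ 0) p≡nd (ℕ.≢-nonZero⁻¹ p)
  instance
    n-nonZero : NonZero n
    n-nonZero = ℕ.m*n≢0⇒m≢0 n {{ℕ.≢-nonZero p≢0}}
    d-nonZero : NonZero d
    d-nonZero = ℕ.m*n≢0⇒n≢0 n {{ℕ.≢-nonZero p≢0}}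
  v : Fin p → ℕ
  v i = suc (toℕ i)
  f : ∀ q .{{_ : NonZero q}} → ℤ
  f q = guard (q ∣? p) (μ (p / q) ℤ.* guard (d ∣? q) 1ℤ)
  n≡1⇒d≡p : n ≡ 1 → d ≡ p
  n≡1⇒d≡p refl = sym (trans p≡nd (ℕ.*-identityˡ d))
  d≡p⇒n≡1 : d ≡ p → n ≡ 1
  d≡p⇒n≡1 refl = ℕ.*-cancelʳ-≡ n 1 d (trans (sym p≡nd) (sym (ℕ.*-identityˡ d)))
  d∣q⇒e∣n : ∀ {q e} → q * e ≡ p → d ∣ q → e ∣ n
  d∣q⇒e∣n {q} {e} qe≡p (divides k q≡kd) = divides k (ℕ.*-cancelʳ-≡ n (k * e) d (begin
    n * d       ≡⟨ p≡nd ⟨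
    p           ≡⟨ qe≡p ⟨
    q * e       ≡⟨ cong (_* e) q≡kd ⟩
    k * d * e   ≡⟨ ℕ.*-assoc k d e ⟩
    k * (d * e) ≡⟨ cong (k *_) (ℕ.*-comm d e) ⟩
    k * (e * d) ≡⟨ ℕ.*-assoc k e d ⟨
    k * e * d   ∎))
  e∣n⇒d∣q : ∀ {q e} .{{_ : NonZero e}} → q * e ≡ p → e ∣ n → d ∣ q
  e∣n⇒d∣q {q} {e} qe≡p (divides k n≡ke) = divides k (ℕ.*-cancelʳ-≡ q (k * d) e (begin
    q * e       ≡⟨ qe≡p ⟩
    p           ≡⟨ p≡nd ⟩
    n * d       ≡⟨ cong (_* d) n≡ke ⟩
    k * e * d   ≡⟨ ℕ.*-assoc k e d ⟩
    k * (e * d) ≡⟨ cong (k *_) (ℕ.*-comm e d) ⟩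
    k * (d * e) ≡⟨ ℕ.*-assoc k d e ⟨
    k * d * e   ∎))
  same : ∀ q e .{{_ : NonZero q}} .{{_ : NonZero e}} → q * e ≡ p → f q ≡ guard (e ∣? n) (μ e)
  same q e qe≡p = begin
    f q                               ≡⟨ guard-yes (q ∣? p) (divides e (sym eq≡p)) ⟩
    μ (p / q) ℤ.* guard (d ∣? q) 1ℤ   ≡⟨ cong₂ (λ z → ℤ._*_ (μ z)) p/q≡e
      (guard-⇔ (d ∣? q) (e ∣? n) (d∣q⇒e∣n qe≡p) (e∣n⇒d∣q qe≡p)) ⟩
    μ e ℤ.* guard (e ∣? n) 1ℤ         ≡⟨ *-guard (e ∣? n) ⟩
    guard (e ∣? n) (μ e)              ∎
    where
    eq≡p = trans (ℕ.*-comm e q) qe≡p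
    p/q≡e : p / q ≡ e
    p/q≡e = trans (cong (_/ q) (sym eq≡p)) (m*n/n≡m e q)
    *-guard : {A : Set a} (d : Dec A) {x : ℤ} → x ℤ.* guard d 1ℤ ≡ guard d x
    *-guard (yes _) {x} = ℤ.*-identityʳ x
    *-guard (no _)  {x} = ℤ.*-zeroʳ x
  onto : ∀ q .{{_ : NonZero q}} (t : Dec (q ∣ p)) →
         guard t (μ (p / q) ℤ.* guard (d ∣? q) 1ℤ) ≡ 0ℤ ⊎ ∃ λ j → q * v j ≡ p
  onto q (no _) = inj₁ refl
  onto q (yes (divides k p≡kq)) =
    let instance k-nonZero = ℕ.m*n≢0⇒m≢0 k {{ℕ.≢-nonZero (subst (_≢ 0) p≡kq (ℕ.≢-nonZero⁻¹ p))}}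
        j , vj≡k = below (∣⇒≤ (divides q (trans p≡kq (ℕ.*-comm k q))))
    in inj₂ (j , trans (cong (q *_) vj≡k) (trans (ℕ.*-comm q k) (sym p≡kq)))
  back : ∀ e .{{_ : NonZero e}} (t : Dec (e ∣ n)) → guard t (μ e) ≡ 0ℤ ⊎ ∃ λ i → v i * e ≡ p
  back e (no _) = inj₁ refl
  back e (yes e∣n) with divides k p≡ke ← ∣-trans e∣n n∣p =
    let instance k-nonZero = ℕ.m*n≢0⇒m≢0 k {{ℕ.≢-nonZero (subst (_≢ 0) p≡ke (ℕ.≢-nonZero⁻¹ p))}}
        i , vi≡k = below (∣⇒≤ (divides e (trans p≡ke (ℕ.*-comm k e))))
    in inj₂ (i , trans (cong (_* e) vi≡k) (sym p≡ke))

-- Periods, orbits and attractors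

least : ∀ {P : Pred ℕ 0ℓ} → Decidable P → ∀ {n} → P n → ∃ λ m → P m × (∀ k → k < m → ¬ P k)
least {P} P? {n} = <-rec (λ n → P n → ∃ λ m → P m × (∀ k → k < m → ¬ P k)) step n
  where
  step : ∀ n → (∀ {k} → k < n → P k → _) → P n → _
  step n rec Pn with ℕ.anyUpTo? P? n
  ... | yes (k , k<n , Pk) = rec k<n Pk
  ... | no none            = n , Pn , λ k k<n Pk → none (_ , k<n , Pk)

divisorSum-cong : ∀ p {f g : (q : ℕ) .{{_ : NonZero q}} → ℤ} →
                  (∀ q .{{_ : NonZero q}} → q ∣ p → f q ≡ g q) → divisorSum p f ≡ divisorSum p g
divisorSum-cong p eq = sum-cong-≗ {p} λ i → guard-cong (suc (toℕ i) ∣? p) (eq (suc (toℕ i)))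

module Iteration {X : Set} (_≟_ : B.DecidableEquality X) (F : X → X) where

  open Endo X using (^-homo) renaming (_^_ to iterate)

  HasPeriod : ℕ → Pred X 0ℓ
  HasPeriod p x = iterate F p x ≡ x

  HasExactPeriod : ℕ → Pred X 0ℓ
  HasExactPeriod p x = HasPeriod p x × (∀ d → 1 ≤ d → d < p → ¬ HasPeriod d x)

  Orbit : X → Pred X 0ℓ
  Orbit x y = ∃ λ k → iterate F k x ≡ y

  IsAttractor : ℕ → Pred (Pred X 0ℓ) 0ℓ
  IsAttractor p A = ∃ λ x → HasExactPeriod p x × A ≐ Orbit x

  hasPeriod? : ∀ p → Decidable (HasPeriod p)
  hasPeriod? p x = iterate F p x ≟ x

  hasExactPeriod? : ∀ p → Decidable (HasExactPeriod p)
  hasExactPeriod? p x = hasPeriod? p x ×-dec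
    map′ (λ f d 1≤d d<p → f {d} d<p 1≤d) (λ f {d} d<p 1≤d → f d 1≤d d<p)
         (ℕ.allUpTo? (λ d → (1 ℕ.≤? d) →-dec ¬? (hasPeriod? d x)) p)

  iterate-+ : ∀ m n x → iterate F (m + n) x ≡ iterate F m (iterate F n x)
  iterate-+ m n x = cong-app (^-homo F m n) x

  iterate-comm : ∀ m n x → iterate F m (iterate F n x) ≡ iterate F n (iterate F m x)
  iterate-comm m n x = begin
    iterate F m (iterate F n x) ≡⟨ iterate-+ m n x ⟨
    iterate F (m + n) x         ≡⟨ cong (λ k → iterate F k x) (ℕ.+-comm m n) ⟩
    iterate F (n + m) x         ≡⟨ iterate-+ n m x ⟩
    iterate F n (iterate F m x) ∎
    where open ≡-Reasoning

  period-* : ∀ {p x} k → HasPeriod p x → HasPeriod (k * p) x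
  period-* zero    per = refl
  period-* {p} {x} (suc k) per =
    trans (iterate-+ p (k * p) x) (trans (cong (iterate F p) (period-* k per)) per)

  period-∣ : ∀ {p q x} → p ∣ q → HasPeriod p x → HasPeriod q x
  period-∣ (divides k refl) = period-* k

  period-iterate : ∀ {p x} k → HasPeriod p x → HasPeriod p (iterate F k x)
  period-iterate {p} {x} k per = trans (iterate-comm p k x) (cong (iterate F k) per)

  iterate-% : ∀ {p x} .{{_ : NonZero p}} k → HasPeriod p x → iterate F (k % p) x ≡ iterate F k x
  iterate-% {p} {x} k per = begin
    iterate F (k % p) x                         ≡⟨ cong (iterate F (k % p)) (period-* (k / p) per) ⟨
    iterate F (k % p) (iterate F (k / p * p) x) ≡⟨ iterate-+ (k % p) (k / p * p) x ⟨
    iterate F (k % p + k / p * p) x             ≡⟨ cong (λ j → iterate F j x) (m≡m%n+[m/n]*n k p) ⟨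
    iterate F k x                               ∎
    where open ≡-Reasoning

  return : ∀ {p x y} .{{_ : NonZero p}} → HasPeriod p x → Orbit x y → Orbit y x
  return {p} {x} per (k , refl) = p ∸ k % p , (begin
    iterate F (p ∸ k % p) (iterate F k x)       ≡⟨ cong (iterate F (p ∸ k % p)) (iterate-% k per) ⟨
    iterate F (p ∸ k % p) (iterate F (k % p) x) ≡⟨ iterate-+ (p ∸ k % p) (k % p) x ⟨
    iterate F (p ∸ k % p + k % p) x             ≡⟨ cong (λ j → iterate F j x) (ℕ.m∸n+n≡m (ℕ.<⇒≤ (m%n<n k p))) ⟩
    iterate F p x                               ≡⟨ per ⟩
    x                                           ∎)
    where open ≡-Reasoning

  orbit-trans : ∀ {x y z} → Orbit x y → Orbit y z → Orbit x z
  orbit-trans {x} (j , refl) (k , refl) = k + j , iterate-+ k j x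

  orbit-≐ : ∀ {p x y} .{{_ : NonZero p}} → HasPeriod p x → Orbit x y → Orbit x ≐ Orbit y
  orbit-≐ per Oxy = orbit-trans (return per Oxy) , orbit-trans Oxy

  exact-iterate : ∀ {p x} .{{_ : NonZero p}} k → HasExactPeriod p x → HasExactPeriod p (iterate F k x)
  exact-iterate {p} {x} k (per , minimal) = period-iterate {p} k per , λ d 1≤d d<p perd →
    let j , eq = return {p} per (k , refl)
    in minimal d 1≤d d<p (subst (HasPeriod d) eq (period-iterate {d} j perd))

  exact-index-≤ : ∀ {p x j k} .{{_ : NonZero p}} → HasExactPeriod p x → k < p →
                  iterate F j x ≡ iterate F k x → k ≤ j
  exact-index-≤ {p} {x} {j} {k} exact k<p eq with k ℕ.≤? j
  ... | yes k≤j = k≤j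
  ... | no k≰j = contradiction period (proj₂ (exact-iterate j exact) (k ∸ j)
                   (ℕ.m<n⇒0<n∸m (ℕ.≰⇒> k≰j)) (ℕ.≤-<-trans (ℕ.m∸n≤m k j) k<p))
    where
    open ≡-Reasoning
    period : HasPeriod (k ∸ j) (iterate F j x)
    period = begin
      iterate F (k ∸ j) (iterate F j x) ≡⟨ iterate-+ (k ∸ j) j x ⟨
      iterate F (k ∸ j + j) x           ≡⟨ cong (λ i → iterate F i x) (ℕ.m∸n+n≡m (ℕ.<⇒≤ (ℕ.≰⇒> k≰j))) ⟩
      iterate F k x                     ≡⟨ eq ⟨
      iterate F j x                     ∎

  minimal-period : ∀ {p x} .{{_ : NonZero p}} → HasPeriod p x →
                   ∃ λ d → 1 ≤ d × HasExactPeriod d x × (∀ q → HasPeriod q x → d ∣ q)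
  minimal-period {suc p} {x} per with least (λ d → hasPeriod? (suc d) x) {p} per
  ... | d , perd , minimal = suc d , s≤s z≤n , (perd , below-d) , λ q perq → ∣-period q perq (q % suc d) refl
    where
    below-d : ∀ e → 1 ≤ e → e < suc d → ¬ HasPeriod e x
    below-d (suc e) _ (s≤s e<d) = minimal e e<d
    ∣-period : ∀ q → HasPeriod q x → ∀ r → q % suc d ≡ r → suc d ∣ q
    ∣-period q perq zero    eq = m%n≡0⇒n∣m q (suc d) eq
    ∣-period q perq (suc r) eq = contradiction
      (subst (λ k → HasPeriod k x) eq (trans (iterate-% q perd) perq))
      (below-d (suc r) (s≤s z≤n) (subst (_< suc d) eq (m%n<n q (suc d))))

  exact-unique : ∀ {d p x} → 1 ≤ d → 1 ≤ p → HasExactPeriod d x → HasExactPeriod p x → d ≡ p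
  exact-unique 1≤d 1≤p (perd , mind) (perp , minp) = ℕ.≤-antisym
    (ℕ.≮⇒≥ λ p<d → mind _ 1≤p p<d perp) (ℕ.≮⇒≥ λ d<p → minp _ 1≤d d<p perd)

  möbius-exact : ∀ p .{{_ : NonZero p}} x →
                 divisorSum p (λ q → μ (p / q) ℤ.* guard (hasPeriod? q x) 1ℤ) ≡
                 guard (hasExactPeriod? p x) 1ℤ
  möbius-exact p x = go (hasPeriod? p x)
    where
    go : Dec (HasPeriod p x) →
         divisorSum p (λ q → μ (p / q) ℤ.* guard (hasPeriod? q x) 1ℤ) ≡ guard (hasExactPeriod? p x) 1ℤ
    go (no ¬per) = trans
      (sum-zero {p} λ i → trans (guard-cong (suc (toℕ i) ∣? p) λ q∣p →
         trans (cong (ℤ._*_ (μ (p / suc (toℕ i)))) (guard-no (hasPeriod? (suc (toℕ i)) x) (¬per ∘ period-∣ q∣p)))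
               (ℤ.*-zeroʳ (μ (p / suc (toℕ i)))))
         (guard-zero (suc (toℕ i) ∣? p)))
      (sym (guard-no (hasExactPeriod? p x) (¬per ∘ proj₁)))
    go (yes per) with minimal-period per
    ... | d , 1≤d , exact , d∣ = trans
      (divisorSum-cong p λ q _ → cong (ℤ._*_ (μ (p / q)))
        (guard-⇔ (hasPeriod? q x) (d ∣? q) {1ℤ} (d∣ q) (λ d∣q → period-∣ d∣q (proj₁ exact))))
      (trans (μ-interval-sum (d∣ p per))
        (guard-⇔ (d ℕ.≟ p) (hasExactPeriod? p x) (λ where refl → exact)
                 (exact-unique 1≤d (ℕ.>-nonZero⁻¹ p) exact)))

  module _ {p : ℕ} .{{_ : NonZero p}} where

    exact-count : ∀ {N} → Enumeration (setoid X) (λ _ → ⊤) N →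
                  (C : (q : ℕ) .{{_ : NonZero q}} → ℕ) →
                  (∀ q .{{_ : NonZero q}} → q ∣ p → Enumeration (setoid X) (HasPeriod q) (C q)) →
                  ∃ λ k → Enumeration (setoid X) (HasExactPeriod p) k ×
                          + k ≡ divisorSum p (λ q → μ (p / q) ℤ.* + C q)
    exact-count {N} all C periodic with subset _ all (hasExactPeriod? p)
    ... | k , E , k≡ = k , E , (begin
      + k ≡⟨ k≡ ⟩
      sum (λ i → guard (hasExactPeriod? p (x i)) 1ℤ) ≡⟨ sum-cong-≗ (λ i → möbius-exact p (x i)) ⟨
      sum (λ i → divisorSum p (λ q → μ (p / q) ℤ.* guard (hasPeriod? q (x i)) 1ℤ)) ≡⟨ ∑-comm {N} {p}
        (λ i j → guard (suc (toℕ j) ∣? p) (μ (p / suc (toℕ j)) ℤ.* guard (hasPeriod? (suc (toℕ j)) (x i)) 1ℤ)) ⟩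
      sum {p} (λ j → sum λ i → guard (suc (toℕ j) ∣? p) (μ (p / suc (toℕ j)) ℤ.* guard (hasPeriod? (suc (toℕ j)) (x i)) 1ℤ))
        ≡⟨ sum-cong-≗ {p} (λ j → count (suc (toℕ j)) (suc (toℕ j) ∣? p)) ⟩
      divisorSum p (λ q → μ (p / q) ℤ.* + C q) ∎)
      where
      open ≡-Reasoning
      x = element all
      count : ∀ q .{{_ : NonZero q}} (d : Dec (q ∣ p)) →
              sum (λ i → guard d (μ (p / q) ℤ.* guard (hasPeriod? q (x i)) 1ℤ)) ≡
              guard d (μ (p / q) ℤ.* + C q)
      count q (no _)    = sum-zero {N} λ _ → refl
      count q (yes q∣p) with subset _ all (hasPeriod? q)
      ... | k , D , k≡ = trans (sym (*-distribˡ-sum {N} (μ (p / q)) λ i → guard (hasPeriod? q (x i)) 1ℤ))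
        (cong (ℤ._*_ (μ (p / q))) (trans (sym k≡) (cong +_ (size-unique D (periodic q q∣p)))))

    attractors : ∀ {k} → Enumeration (setoid X) (HasExactPeriod p) k →
                 ∃ λ m → Enumeration (≐-setoid X 0ℓ) (IsAttractor p) m
    attractors E with image (≐-setoid X 0ℓ) (Orbit ∘ element E) same?
      where
      same? : ∀ i j → Dec (Orbit (element E i) ≐ Orbit (element E j))
      same? i j = map′
        (λ (k , eq) → orbit-≐ per (toℕ k , eq))
        (λ (_ , j⊆i) → let k , eq = j⊆i (0 , refl) in
          fromℕ< (m%n<n k p) , trans (cong (λ l → iterate F l (element E i)) (toℕ-fromℕ< (m%n<n k p)))
                                     (trans (iterate-% k per) eq))
        (any? λ k → iterate F (toℕ k) (element E i) ≟ element E j)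
        where
        per : HasPeriod p (element E i)
        per = proj₁ (sound E i)
    ... | m , D = m , respects-⇔
      (λ (i , eq) → element E i , sound E i , ≐-sym eq)
      (λ (x , exact , eq) → let i , x≡ = complete E exact in
        i , subst (λ y → Orbit y ≐ _) (sym x≡) (≐-sym eq))
      D

    exact-attractors : ∀ {m} → Enumeration (≐-setoid X 0ℓ) (IsAttractor p) m →
                       Enumeration (setoid X) (HasExactPeriod p) (m * p)
    exact-attractors {m} D = record
      { element   = λ j → point (remQuot p j)
      ; sound     = λ j → let i , c = remQuot p j in exact-iterate (toℕ c) (exact i)
      ; injective = λ {j} {j′} eq → trans (sym (combine-remQuot {m} p j))
          (trans (cong (uncurry combine) (point-injective (remQuot p j) (remQuot p j′) eq))
                 (combine-remQuot {m} p j′))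
      ; complete  = λ {y} exact-y →
          let i , eq = complete D (y , exact-y , ≐-refl)
              k , eq′ = proj₂ (≐-trans (≐-sym (isOrbit i)) eq) (0 , refl)
              c = fromℕ< (m%n<n k p)
          in combine i c , (begin
               point (remQuot p (combine i c)) ≡⟨ cong point (remQuot-combine i c) ⟩
               iterate F (toℕ c) (rep i)       ≡⟨ cong (λ l → iterate F l (rep i)) (toℕ-fromℕ< (m%n<n k p)) ⟩
               iterate F (k % p) (rep i)       ≡⟨ iterate-% k (proj₁ (exact i)) ⟩
               iterate F k (rep i)             ≡⟨ eq′ ⟩
               y                               ∎)
      }
      where
      open ≡-Reasoning
      rep : Fin m → X
      rep i = proj₁ (sound D i)
      exact : ∀ i → HasExactPeriod p (rep i)
      exact i = proj₁ (proj₂ (sound D i))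
      isOrbit : ∀ i → element D i ≐ Orbit (rep i)
      isOrbit i = proj₂ (proj₂ (sound D i))
      point : Fin m × Fin p → X
      point (i , c) = iterate F (toℕ c) (rep i)
      orbit : ∀ i c → element D i ≐ Orbit (point (i , c))
      orbit i c = ≐-trans (isOrbit i) (orbit-≐ (proj₁ (exact i)) (toℕ c , refl))
      point-injective : ∀ z z′ → point z ≡ point z′ → z ≡ z′
      point-injective (i , c) (i′ , c′) eq with injective D
        (≐-trans (orbit i c) (subst (λ x → Orbit x ≐ element D i′) (sym eq) (≐-sym (orbit i′ c′))))
      ... | refl = cong (i ,_) (toℕ-injective (ℕ.≤-antisym
        (exact-index-≤ (exact i) (toℕ<n c) (sym eq)) (exact-index-≤ (exact i) (toℕ<n c′) eq)))

-- Periodic sequences without zeros at distance ℓ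

∷-enumeration : {P : Pred (Vec Bool (suc n)) 0ℓ} →
                Enumeration (setoid (Vec Bool n)) (λ w → P (false ∷ w)) k →
                Enumeration (setoid (Vec Bool n)) (λ w → P (true ∷ w)) k′ →
                Enumeration (setoid (Vec Bool (suc n))) P (k + k′)
∷-enumeration {n} {P = P} D E = respects-⇔
  (λ where (inj₁ (w , Pw , refl)) → Pw
           (inj₂ (w , Pw , refl)) → Pw)
  (λ { {false ∷ w} Pw → inj₁ (w , Pw , refl)
     ; {true ∷ w}  Pw → inj₂ (w , Pw , refl) })
  (union (λ where (_ , _ , refl) (_ , _ , refl) ()) (prepend false D) (prepend true E))
  where
  prepend : ∀ b {k} → Enumeration (setoid (Vec Bool n)) (λ w → P (b ∷ w)) k →
            Enumeration (setoid (Vec Bool (suc n))) (λ v → ∃ λ w → P (b ∷ w) × b ∷ w ≡ v) k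
  prepend b = transport (b ∷_) (cong (b ∷_)) (λ Pw → _ , Pw , refl) (λ _ _ → ∷-injectiveʳ) id

all-Vec : ∀ n → ∃ λ N → Enumeration (setoid (Vec Bool n)) (λ _ → ⊤) N
all-Vec zero    = 1 , respects-⇔ _ (λ { {[]} _ → refl }) (singleton _ [])
all-Vec (suc n) = let _ , E = all-Vec n in _ , ∷-enumeration E E

Walk : Bool → Vec Bool n → Bool → Set
Walk a []      b = a ∨ b ≡ true
Walk a (x ∷ w) b = a ∨ x ≡ true × Walk x w b

walks : Bool → Bool → ℕ → ℕ
walks a b zero    = if a ∨ b then 1 else 0
walks a b (suc n) = (if a then walks false b n else 0) + walks true b n

walk-enumeration : ∀ a b n → Enumeration (setoid (Vec Bool n)) (λ w → Walk a w b) (walks a b n)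
walk-enumeration a b zero with a ∨ b in eq
... | false = empty λ { {[]} a∨b → contradiction (trans (sym eq) a∨b) λ () }
... | true  = respects-⇔ (λ where refl → eq) (λ { {[]} _ → refl }) (singleton _ [])
walk-enumeration false b (suc n) = ∷-enumeration (empty λ where (() , _))
  (respects-⇔ (refl ,_) proj₂ (walk-enumeration true b n))
walk-enumeration true b (suc n) = ∷-enumeration
  (respects-⇔ (refl ,_) proj₂ (walk-enumeration false b n))
  (respects-⇔ (refl ,_) proj₂ (walk-enumeration true b n))

walks-recurrence : ∀ a b n → walks a b (2 + n) ≡ walks a b (1 + n) + walks a b n
walks-recurrence false b n = ℕ.+-comm (walks false b n) (walks true b n)
walks-recurrence true  b n = ℕ.+-comm (walks true b n) (walks true b (suc n))

closed-walks : ∀ n → walks false false n + walks true true n ≡ L (suc n)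
closed-walks zero          = refl
closed-walks (suc zero)    = refl
closed-walks (suc (suc n)) = begin
  walks false false (2 + n) + walks true true (2 + n)
    ≡⟨ cong₂ _+_ (walks-recurrence false false n) (walks-recurrence true true n) ⟩
  (walks false false (1 + n) + walks false false n) + (walks true true (1 + n) + walks true true n)
    ≡⟨ interchange (walks false false (1 + n)) _ (walks true true (1 + n)) _ ⟩
  (walks false false (1 + n) + walks true true (1 + n)) + (walks false false n + walks true true n)
    ≡⟨ cong₂ _+_ (closed-walks (suc n)) (closed-walks n) ⟩
  L (2 + n) + L (1 + n) ∎
  where
  open ≡-Reasoning
  interchange : ∀ a b c d → (a + b) + (c + d) ≡ (a + c) + (b + d)
  interchange = solve-∀

seq : Bool → Vec Bool n → Bool → ℕ → Bool
seq a w       b zero    = a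
seq a []      b (suc i) = b
seq a (x ∷ w) b (suc i) = seq x w b i

seq-last : ∀ a (w : Vec Bool n) b → seq a w b (suc n) ≡ b
seq-last a []      b = refl
seq-last a (x ∷ w) b = seq-last x w b

seq-adjacent : ∀ a (w : Vec Bool n) b → Walk a w b → ∀ {i} → i ≤ n →
               seq a w b i ∨ seq a w b (suc i) ≡ true
seq-adjacent a []      b a∨b       {zero}  _         = a∨b
seq-adjacent a (x ∷ w) b (a∨x , _) {zero}  _         = a∨x
seq-adjacent a (x ∷ w) b (_ , xwb) {suc i} (s≤s i≤n) = seq-adjacent x w b xwb i≤n

seq-injective : ∀ a (w : Vec Bool n) b a′ (w′ : Vec Bool n) b′ →
                (∀ i → i ≤ n → seq a w b i ≡ seq a′ w′ b′ i) → a ∷ w ≡ a′ ∷ w′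
seq-injective a []      b a′ []        b′ eq = cong (_∷ []) (eq 0 z≤n)
seq-injective a (x ∷ w) b a′ (x′ ∷ w′) b′ eq =
  cong₂ _∷_ (eq 0 z≤n) (seq-injective x w b x′ w′ b′ λ i i≤n → eq (suc i) (s≤s i≤n))

walk-tabulate : ∀ (V : ℕ → Bool) → (∀ i → V i ∨ V (suc i) ≡ true) →
                Walk (V 0) (tabulate {n = n} (V ∘ suc ∘ toℕ)) (V (suc n))
walk-tabulate {zero}  V adj = adj 0
walk-tabulate {suc n} V adj = adj 0 , walk-tabulate (V ∘ suc) (adj ∘ suc)

seq-tabulate : ∀ (V : ℕ → Bool) {i} → i ≤ suc n →
               seq (V 0) (tabulate {n = n} (V ∘ suc ∘ toℕ)) (V (suc n)) i ≡ V i
seq-tabulate         V {zero}        _         = refl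
seq-tabulate {zero}  V {suc zero}    (s≤s _)   = refl
seq-tabulate {suc n} V {suc i}       (s≤s i≤n) = seq-tabulate (V ∘ suc) i≤n

Periodic : ℕ → Pred (ℕ → Bool) 0ℓ
Periodic p W = ∀ i → W (i + p) ≡ W i

Admissible : ℕ → ℕ → Pred (ℕ → Bool) 0ℓ
Admissible p ℓ W = Periodic p W × (∀ i → W i ∨ W (i + ℓ) ≡ true)

periodic-* : ∀ {p W} → Periodic p W → ∀ k i → W (i + k * p) ≡ W i
periodic-* {W = W} per zero    i = cong W (ℕ.+-identityʳ i)
periodic-* {p} {W} per (suc k) i = begin
  W (i + (p + k * p)) ≡⟨ cong (λ z → W (i + z)) (ℕ.+-comm p (k * p)) ⟩
  W (i + (k * p + p)) ≡⟨ cong W (ℕ.+-assoc i (k * p) p) ⟨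
  W (i + k * p + p)   ≡⟨ per (i + k * p) ⟩
  W (i + k * p)       ≡⟨ periodic-* {W = W} per k i ⟩
  W i                 ∎
  where open ≡-Reasoning

periodic-≡ : ∀ {p W} → Periodic p W → ∀ {i j} a b → i + a * p ≡ j + b * p → W i ≡ W j
periodic-≡ {W = W} per {i} {j} a b eq =
  trans (sym (periodic-* {W = W} per a i)) (trans (cong W eq) (periodic-* {W = W} per b j))

periodic-% : ∀ {p W} .{{_ : NonZero p}} → Periodic p W → ∀ i → W (i % p) ≡ W i
periodic-% {p} {W} per i = periodic-≡ {W = W} per (i / p) 0
  (trans (sym (m≡m%n+[m/n]*n i p)) (sym (ℕ.+-identityʳ i)))

suc-%-reduce : ∀ i n → suc i % suc n ≡ suc (i % suc n) % suc n
suc-%-reduce i n = trans (cong (λ z → suc z % suc n) (m≡m%n+[m/n]*n i (suc n)))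
                         ([m+kn]%n≡m%n (suc (i % suc n)) (i / suc n) (suc n))

suc-% : ∀ i n → suc i % suc n ≡ suc (i % suc n) ⊎ (i % suc n ≡ n × suc i % suc n ≡ 0)
suc-% i n with ℕ.m≤n⇒m<n∨m≡n (ℕ.≤-pred (m%n<n i (suc n)))
... | inj₁ i%<n = inj₁ (trans (suc-%-reduce i n) (m<n⇒m%n≡m (s≤s i%<n)))
... | inj₂ i%≡n = inj₂ (i%≡n ,
  trans (suc-%-reduce i n) (trans (cong (λ z → suc z % suc n) i%≡n) (n%n≡0 (suc n))))

ClosedWalk : Pred (Vec Bool (suc n)) 0ℓ
ClosedWalk (x ∷ w) = Walk x w x

unroll : Vec Bool (suc n) → ℕ → Bool
unroll {n} (x ∷ w) i = seq x w x (i % suc n)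

lucas-enumeration : ∀ m .{{_ : NonZero m}} → Enumeration (ℕ →-setoid Bool) (Admissible m 1) (L m)
lucas-enumeration (suc n) = subst (Enumeration _ _) (closed-walks n)
  (transport unroll (λ where refl _ → refl)
    (λ {v} walk → periodic v , adjacent v walk)
    (λ {v} {v′} _ _ eq → injective′ v v′ eq)
    (λ {W} (per , adj) → W 0 ∷ tabulate (W ∘ suc ∘ toℕ) ,
       subst (Walk (W 0) _) (per 0) (walk-tabulate W (λ i → trans (cong (λ j → W i ∨ W j) (ℕ.+-comm 1 i)) (adj i))) ,
       surjective W per)
    (∷-enumeration (walk-enumeration false false n) (walk-enumeration true true n)))
  where
  periodic : (v : Vec Bool (suc n)) → Periodic (suc n) (unroll v)
  periodic (x ∷ w) i = cong (seq x w x) ([m+n]%n≡m%n i (suc n))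
  adjacent : (v : Vec Bool (suc n)) → ClosedWalk v → ∀ i → unroll v i ∨ unroll v (i + 1) ≡ true
  adjacent (x ∷ w) walk i =
    trans (cong (seq x w x (i % suc n) ∨_) (trans (cong (unroll (x ∷ w)) (ℕ.+-comm i 1)) (next (suc-% i n))))
          (seq-adjacent x w x walk (ℕ.≤-pred (m%n<n i (suc n))))
    where
    next : suc i % suc n ≡ suc (i % suc n) ⊎ (i % suc n ≡ n × suc i % suc n ≡ 0) →
           seq x w x (suc i % suc n) ≡ seq x w x (suc (i % suc n))
    next (inj₁ eq) = cong (seq x w x) eq
    next (inj₂ (eq , eq′)) = trans (cong (seq x w x) eq′)
      (sym (trans (cong (seq x w x ∘ suc) eq) (seq-last x w x)))
  injective′ : (v v′ : Vec Bool (suc n)) → unroll v ≗ unroll v′ → v ≡ v′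
  injective′ (x ∷ w) (x′ ∷ w′) eq = seq-injective x w x x′ w′ x′ λ i i≤n →
    subst (λ j → seq x w x j ≡ seq x′ w′ x′ j) (m<n⇒m%n≡m (s≤s i≤n)) (eq i)
  surjective : ∀ W → Periodic (suc n) W → unroll (W 0 ∷ tabulate (W ∘ suc ∘ toℕ)) ≗ W
  surjective W per i = begin
    seq (W 0) (tabulate (W ∘ suc ∘ toℕ)) (W 0) (i % suc n)
      ≡⟨ cong (λ b → seq (W 0) (tabulate (W ∘ suc ∘ toℕ)) b (i % suc n)) (per 0) ⟨
    seq (W 0) (tabulate (W ∘ suc ∘ toℕ)) (W (suc n)) (i % suc n)
      ≡⟨ seq-tabulate W (ℕ.<⇒≤ (m%n<n i (suc n))) ⟩
    W (i % suc n) ≡⟨ periodic-% {W = W} per i ⟩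
    W i ∎
    where open ≡-Reasoning

mod-inverse : ∀ {l m} → Coprime l m → ∃ λ u → ∃₂ λ a b → l * u + a * m ≡ 1 + b * m
mod-inverse {l} {m} c with coprime-Bézout c
... | Bézout.+- x y eq = x , 0 , y , trans (trans (ℕ.+-identityʳ (l * x)) (ℕ.*-comm l x)) (sym eq)
-- Here x is an inverse of -l, so x (x l) is an inverse of l.
... | Bézout.-+ x y eq = x * (x * l) , 2 * y , y * m * y , (begin
  l * (x * (x * l)) + 2 * y * m             ≡⟨ cong (λ z → l * (x * (x * l)) + z) (ℕ.*-assoc 2 y m) ⟩
  l * (x * (x * l)) + 2 * (y * m)           ≡⟨ cong (λ z → l * (x * (x * l)) + 2 * z) eq ⟨
  l * (x * (x * l)) + 2 * (1 + x * l)       ≡⟨ square x l ⟩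
  1 + (1 + x * l) * (1 + x * l)             ≡⟨ cong (λ z → 1 + z * z) eq ⟩
  1 + (y * m) * (y * m)                     ≡⟨ cong suc (ℕ.*-assoc (y * m) y m) ⟨
  1 + y * m * y * m                         ∎)
  where
  open ≡-Reasoning
  square : ∀ x l → l * (x * (x * l)) + 2 * (1 + x * l) ≡ 1 + (1 + x * l) * (1 + x * l)
  square = solve-∀

-- Reading W along the multiples of u = l⁻¹ mod m turns steps of 1 into steps of l.
coprime-enumeration : ∀ {l} → Coprime l m →
                      Enumeration (ℕ →-setoid Bool) (Admissible m 1) k →
                      Enumeration (ℕ →-setoid Bool) (Admissible m l) k
coprime-enumeration {m} {l = l} c with mod-inverse c
... | u , a , b , eq = transport (λ W i → W (i * u)) (λ W≗V i → W≗V (i * u))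
  (λ {W} (per , adj) →
    (λ i → periodic-≡ {W = W} per 0 u (shift i m u)) ,
    (λ i → trans (cong (W (i * u) ∨_) (periodic-≡ {W = W} per a b (advance i))) (adj (i * u))))
  (λ {W} {V} (per , _) (per′ , _) W≗V i → trans (sym (undo per i)) (trans (W≗V (i * l)) (undo per′ i)))
  (λ {V} (per , adj) → (λ i → V (i * l)) ,
    ((λ i → periodic-≡ {W = V} per 0 l (shift i m l)) ,
     (λ i → trans (cong (λ j → V (i * l) ∨ V j) (advance′ i)) (adj (i * l)))) ,
    λ i → trans (cong V (*-swap i l u)) (undo per i))
  where
  shift : ∀ i m u → (i + m) * u + 0 ≡ i * u + u * m
  shift = solve-∀
  *-swap : ∀ i l u → i * u * l ≡ i * l * u
  *-swap = solve-∀
  advance : ∀ i → (i + l) * u + a * m ≡ i * u + 1 + b * m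
  advance i = trans (expand i l u a m)
    (trans (cong (λ z → i * u + z) eq) (sym (ℕ.+-assoc (i * u) 1 (b * m))))
    where
    expand : ∀ i l u a m → (i + l) * u + a * m ≡ i * u + (l * u + a * m)
    expand = solve-∀
  advance′ : ∀ i → (i + 1) * l ≡ i * l + l
  advance′ i = trans (ℕ.*-distribʳ-+ l i 1) (cong (λ z → i * l + z) (ℕ.*-identityˡ l))
  undo : ∀ {W} → Periodic m W → ∀ i → W (i * l * u) ≡ W i
  undo {W} per i = periodic-≡ {W = W} per (i * a) (i * b)
    (trans (factor i l u a m) (trans (cong (i *_) eq) (expand i b m)))
    where
    factor : ∀ i l u a m → i * l * u + i * a * m ≡ i * (l * u + a * m)
    factor = solve-∀
    expand : ∀ i b m → i * (1 + b * m) ≡ i + i * b * m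
    expand = solve-∀

funToFin-cong : ∀ {m n} {f g : Fin m → Fin n} → f ≗ g → funToFin f ≡ funToFin g
funToFin-cong {zero}  f≗g = refl
funToFin-cong {suc m} f≗g = cong₂ combine (f≗g zero) (funToFin-cong (f≗g ∘ suc))

finToFun-injective : ∀ {m n} {i j : Fin (m ^ n)} → finToFun {m} {n} i ≗ finToFun j → i ≡ j
finToFun-injective {m} {n} {i} {j} eq =
  trans (sym (funToFin-finToFin {n} {m} i)) (trans (funToFin-cong eq) (funToFin-finToFin {n} {m} j))

interleave : ∀ {l} g .{{_ : NonZero g}} →
             Enumeration (ℕ →-setoid Bool) (Admissible m l) k →
             Enumeration (ℕ →-setoid Bool) (Admissible (m * g) (l * g)) (k ^ g)
interleave {m} {k} {l} g E = record
  { element   = weave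
  ; sound     = λ n → (λ i → trans (jump n i m) (proj₁ (good n i) (i / g))) ,
                      (λ i → trans (cong (weave n i ∨_) (jump n i l)) (proj₂ (good n i) (i / g)))
  ; injective = λ {n} {n′} eq → finToFun-injective {k} {g} λ c → injective E λ j →
      trans (sym (weave-at n c j)) (trans (eq (toℕ c + j * g)) (weave-at n′ c j))
  ; complete  = λ {W} (per , adj) →
      let strand = λ (c : Fin g) → complete E (strand-admissible W per adj (toℕ c))
      in funToFin (λ c → proj₁ (strand c)) , λ i → begin
           weave (funToFin (λ c → proj₁ (strand c))) i
             ≡⟨ cong (λ z → element E z (i / g)) (finToFun-funToFin (λ c → proj₁ (strand c)) (i mod g)) ⟩
           element E (proj₁ (strand (i mod g))) (i / g)
             ≡⟨ proj₂ (strand (i mod g)) (i / g) ⟩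
           W (toℕ (i mod g) + i / g * g)
             ≡⟨ cong (λ z → W (z + i / g * g)) (toℕ-fromℕ< (m%n<n i g)) ⟩
           W (i % g + i / g * g)
             ≡⟨ cong W (m≡m%n+[m/n]*n i g) ⟨
           W i ∎
  }
  where
  open ≡-Reasoning
  weave : Fin (k ^ g) → ℕ → Bool
  weave n i = element E (finToFun n (i mod g)) (i / g)
  good : ∀ n i → Admissible m l (element E (finToFun {k} {g} n (i mod g)))
  good n i = sound E (finToFun n (i mod g))
  mod-cong : ∀ {i j} → i % g ≡ j % g → i mod g ≡ j mod g
  mod-cong {i} {j} eq = toℕ-injective
    (trans (toℕ-fromℕ< (m%n<n i g)) (trans eq (sym (toℕ-fromℕ< (m%n<n j g)))))
  /-jump : ∀ i q → (i + q * g) / g ≡ i / g + q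
  /-jump i q = trans (+-distrib-/-∣ʳ i (n∣m*n q)) (cong (λ z → i / g + z) (m*n/n≡m q g))
  jump : ∀ n i q → weave n (i + q * g) ≡ element E (finToFun n (i mod g)) (i / g + q)
  jump n i q = cong₂ (λ c j → element E (finToFun n c) j)
    (mod-cong ([m+kn]%n≡m%n i q g)) (/-jump i q)
  weave-at : ∀ n (c : Fin g) j → weave n (toℕ c + j * g) ≡ element E (finToFun n c) j
  weave-at n c j = trans (jump n (toℕ c) j) (cong₂ (λ c j → element E (finToFun n c) j)
    (toℕ-injective (trans (toℕ-fromℕ< (m%n<n (toℕ c) g)) (m<n⇒m%n≡m (toℕ<n c))))
    (cong (_+ j) (m<n⇒m/n≡0 (toℕ<n c))))
  strand-admissible : ∀ W → Periodic (m * g) W → (∀ i → W i ∨ W (i + l * g) ≡ true) →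
                      ∀ c → Admissible m l (λ j → W (c + j * g))
  strand-admissible W per adj c =
    (λ j → trans (cong W (expand c j m g)) (per (c + j * g))) ,
    (λ j → trans (cong (λ z → W (c + j * g) ∨ W z) (expand c j l g)) (adj (c + j * g)))
    where
    expand : ∀ c j m g → c + (j + m) * g ≡ c + j * g + m * g
    expand = solve-∀

admissible-enumeration : ∀ ℓ p .{{_ : NonZero p}} → Enumeration (ℕ →-setoid Bool) (Admissible p ℓ)
                         (L ((p / gcd ℓ p) {{gcd-nonZero ℓ p}}) ^ gcd ℓ p)
admissible-enumeration ℓ p =
  subst₂ (λ p′ ℓ′ → Enumeration (ℕ →-setoid Bool) (Admissible p′ ℓ′) (L (p / gcd ℓ p) ^ gcd ℓ p)) (m/n*n≡m g∣p) (m/n*n≡m (gcd[m,n]∣m ℓ p))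
    (interleave (gcd ℓ p) (coprime-enumeration (coprime-/gcd ℓ p)
      (lucas-enumeration (p / gcd ℓ p) {{>-nonZero (m≥n⇒m/n>0 (∣⇒≤ g∣p))}})))
  where
  instance _ = gcd-nonZero ℓ p
  g∣p = gcd[m,n]∣n ℓ p

-- The circuit

push : Bool → (ℕ → Bool) → ℕ → Bool
push c α zero    = c
push c α (suc i) = α i

nth : Vec Bool n → ℕ → Bool
nth []      _       = false
nth (x ∷ v) zero    = x
nth (x ∷ v) (suc i) = nth v i

tabulate-nth : (v : Vec Bool n) → tabulate (nth v ∘ toℕ) ≡ v
tabulate-nth []      = refl
tabulate-nth (x ∷ v) = cong (x ∷_) (tabulate-nth v)

last-tabulate : ∀ n (α : ℕ → Bool) → last (tabulate {n = suc n} (α ∘ toℕ)) ≡ α n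
last-tabulate zero    α = refl
last-tabulate (suc n) α = last-tabulate n (α ∘ suc)

tabulate-injective : ∀ n {α β : ℕ → Bool} → tabulate {n = n} (α ∘ toℕ) ≡ tabulate (β ∘ toℕ) →
                     ∀ {i} → i < n → α i ≡ β i
tabulate-injective n {α} {β} eq {i} i<n = begin
  α i                               ≡⟨ at α ⟨
  lookup (tabulate (α ∘ toℕ)) (fromℕ< i<n) ≡⟨ cong (λ v → lookup v (fromℕ< i<n)) eq ⟩
  lookup (tabulate (β ∘ toℕ)) (fromℕ< i<n) ≡⟨ at β ⟩
  β i                               ∎
  where
  open ≡-Reasoning
  at : ∀ γ → lookup (tabulate (γ ∘ toℕ)) (fromℕ< i<n) ≡ γ i
  at γ = trans (lookup∘tabulate (γ ∘ toℕ) (fromℕ< i<n)) (cong γ (toℕ-fromℕ< i<n))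

tabulate-cong-< : ∀ n {α β : ℕ → Bool} → (∀ {i} → i < n → α i ≡ β i) →
                  tabulate {n = n} (α ∘ toℕ) ≡ tabulate (β ∘ toℕ)
tabulate-cong-< n eq = tabulate-cong λ i → eq (toℕ<n i)

tabulate-shift : ∀ l s (α β : ℕ → Bool) →
  tabulate (λ i → if toℕ i ≡ᵇ l then β 0 else
    lookup (α 0 ∷ (tabulate {n = l} (α ∘ suc ∘ toℕ) ++ tabulate {n = s} (β ∘ suc ∘ toℕ))) (inject₁ i)) ≡
  tabulate {n = l} (α ∘ toℕ) ++ tabulate {n = s} (β ∘ toℕ)
tabulate-shift (suc l) s α β = cong (α 0 ∷_) (tabulate-shift l s (α ∘ suc) β)
tabulate-shift zero    s α β = tabulate-cong λ where
  zero    → refl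
  (suc j) → trans (lookup∘tabulate (β ∘ suc ∘ toℕ) (inject₁ j)) (cong (β ∘ suc) (toℕ-inject₁ j))

module _ (l s : ℕ) where

  open DoubleCircuit (suc l) (suc s)
  open Endo Config using () renaming (_^_ to iterate)
  open Iteration (≡-dec _≟ᵇ_) F using (iterate-+)

  -- The state at depth d, that is d arcs after node 0, is α d on the left-circuit and β d on
  -- the right-circuit.
  spread : (α β : ℕ → Bool) → Config
  spread α β = α 0 ∷ (tabulate {n = l} (α ∘ suc ∘ toℕ) ++ tabulate {n = s} (β ∘ suc ∘ toℕ))

  spread-cong : ∀ {α β α′ β′} → (∀ {i} → i ≤ l → α i ≡ α′ i) → (∀ {i} → i ≤ s → β i ≡ β′ i) →
                spread α β ≡ spread α′ β′
  spread-cong α≡ β≡ = cong₂ _∷_ (α≡ z≤n) (cong₂ _++_ (tabulate-cong-< l α≡) (tabulate-cong-< s β≡))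

  diagonal-cong : ∀ {W V} → W ≗ V → spread W W ≡ spread V V
  diagonal-cong {W} {V} W≗V = spread-cong {W} {W} {V} {V} (λ {i} _ → W≗V i) (λ {i} _ → W≗V i)

  spread-injective : ∀ {α β α′ β′} → α 0 ≡ β 0 → α′ 0 ≡ β′ 0 → spread α β ≡ spread α′ β′ →
                     (∀ {i} → i ≤ l → α i ≡ α′ i) × (∀ {i} → i ≤ s → β i ≡ β′ i)
  spread-injective {α} {β} {α′} {β′} α≡β α′≡β′ eq = left , right
    where
    head-eq = proj₁ (∷-injective eq)
    tails-eq = ++-injective (tabulate (α ∘ suc ∘ toℕ)) (tabulate (α′ ∘ suc ∘ toℕ)) (proj₂ (∷-injective eq))
    left : ∀ {i} → i ≤ l → α i ≡ α′ i
    left {zero}  _   = head-eq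
    left {suc i} i<l = tabulate-injective l (proj₁ tails-eq) i<l
    right : ∀ {i} → i ≤ s → β i ≡ β′ i
    right {zero}  _   = trans (sym α≡β) (trans head-eq α′≡β′)
    right {suc i} i<s = tabulate-injective s (proj₂ tails-eq) i<s

  spread-surjective : ∀ x → ∃₂ λ α β → α 0 ≡ β 0 × spread α β ≡ x
  spread-surjective (h ∷ v) = push h (nth (take l v)) , push h (nth (drop l v)) , refl ,
    cong (h ∷_) (trans (cong₂ _++_ (tabulate-nth (take l v)) (tabulate-nth (drop l v)))
                       (take++drop≡id l v))

  feedback : (α β : ℕ → Bool) → Bool
  feedback α β = not (α l) ∨ β s

  F-spread : ∀ α β → α 0 ≡ β 0 →
             F (spread α β) ≡ spread (push (feedback α β) α) (push (feedback α β) β)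
  F-spread α β α≡β = cong₂ _∷_
    (cong₂ (λ a b → not a ∨ b)
      (trans (cong (λ v → last (α 0 ∷ v)) (proj₁ split)) (last-tabulate l α))
      (trans (cong₂ (λ h v → last (h ∷ v)) α≡β (proj₂ split)) (last-tabulate s β)))
    (trans (tabulate-cong λ i → cong (λ h → if toℕ i ≡ᵇ l then h else lookup (α 0 ∷ (A ++ B)) (inject₁ i)) α≡β) (tabulate-shift l s α β))
    where
    A = tabulate {n = l} (α ∘ suc ∘ toℕ)
    B = tabulate {n = s} (β ∘ suc ∘ toℕ)
    split : take l (A ++ B) ≡ A × drop l (A ++ B) ≡ B
    split = ++-injective (take l (A ++ B)) A (take++drop≡id l (A ++ B))

  module Trajectory (α₀ β₀ : ℕ → Bool) (α₀≡β₀ : α₀ 0 ≡ β₀ 0) where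

    α β : ℕ → ℕ → Bool
    α zero    = α₀
    α (suc t) = push (feedback (α t) (β t)) (α t)
    β zero    = β₀
    β (suc t) = push (feedback (α t) (β t)) (β t)

    α≡β : ∀ t → α t 0 ≡ β t 0
    α≡β zero    = α₀≡β₀
    α≡β (suc t) = refl

    iterate-spread : ∀ t → iterate F t (spread α₀ β₀) ≡ spread (α t) (β t)
    iterate-spread zero    = refl
    iterate-spread (suc t) = trans (cong F (iterate-spread t)) (F-spread (α t) (β t) (α≡β t))

    σ : ℕ → Bool
    σ t = α t 0

    α-depth : ∀ d t → α (d + t) d ≡ σ t
    α-depth zero    t = refl
    α-depth (suc d) t = α-depth d t

    β-depth : ∀ d t → β (d + t) d ≡ σ t
    β-depth zero    t = sym (α≡β t)
    β-depth (suc d) t = β-depth d t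

    σ-recurrence : ∀ t → σ (t + suc l + suc s) ≡ not (σ (t + suc s)) ∨ σ (t + suc l)
    σ-recurrence t = trans (cong σ (rearrange t l s)) (cong₂ (λ a b → not a ∨ b)
      (trans (cong (λ z → α z l) (rearrange₁ t l s)) (α-depth l (t + suc s)))
      (trans (cong (λ z → β z s) (rearrange₂ t l s)) (β-depth s (t + suc l))))
      where
      rearrange : ∀ t l s → t + suc l + suc s ≡ suc (t + l + suc s)
      rearrange = solve-∀
      rearrange₁ : ∀ t l s → t + l + suc s ≡ l + (t + suc s)
      rearrange₁ = solve-∀
      rearrange₂ : ∀ t l s → t + l + suc s ≡ s + (t + suc l)
      rearrange₂ = solve-∀

  rotate-spread : ∀ {p W} → suc p ∣ suc s → Admissible (suc p) (suc l) W →
                  F (spread W W) ≡ spread (W ∘ (λ i → i + p)) (W ∘ (λ i → i + p))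
  rotate-spread {p} {W} (divides k s≡) (per , adj) = trans (F-spread W W refl)
    (diagonal-cong rotated)
    where
    absorb : ∀ a b → a ∨ b ≡ true → not b ∨ a ≡ a
    absorb a     false eq = trans (sym eq) (∨-comm a false)
    absorb a     true  eq = refl
    left : W (p + suc l) ≡ W l
    left = trans (cong W (trans (ℕ.+-suc p l) (ℕ.+-comm (suc p) l))) (per l)
    right : W s ≡ W p
    right = periodic-≡ {W = W} per 1 k (trans (swap s p) (cong (_+_ p) s≡))
      where
      swap : ∀ s p → s + 1 * suc p ≡ p + suc s
      swap = solve-∀
    rotated : ∀ i → push (feedback W W) W i ≡ W (i + p)
    rotated zero    = trans (cong (not (W l) ∨_) right)
      (absorb (W p) (W l) (trans (cong (W p ∨_) (sym left)) (adj p)))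
    rotated (suc i) = sym (trans (cong W (sym (ℕ.+-suc i p))) (per i))

  admissible-shift : ∀ {p ℓ W} k → Admissible p ℓ W → Admissible p ℓ (W ∘ (λ i → i + k))
  admissible-shift {p} {ℓ} {W} k (per , adj) =
    (λ i → trans (cong W (swap i p k)) (per (i + k))) ,
    (λ i → trans (cong (λ j → W (i + k) ∨ W j) (swap i ℓ k)) (adj (i + k)))
    where
    swap : ∀ i p k → i + p + k ≡ i + k + p
    swap = solve-∀

  iterate-rotate : ∀ {p W} → suc p ∣ suc s → Admissible (suc p) (suc l) W → ∀ t →
                   iterate F t (spread W W) ≡ spread (W ∘ (λ i → i + t * p)) (W ∘ (λ i → i + t * p))
  iterate-rotate {p} {W} p∣r adm zero = diagonal-cong eq
    where
    eq : ∀ i → W i ≡ W (i + 0)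
    eq i = cong W (sym (ℕ.+-identityʳ i))
  iterate-rotate {p} {W} p∣r adm (suc t) = trans (cong F (iterate-rotate p∣r adm t))
    (trans (rotate-spread {W = W ∘ (λ i → i + t * p)} p∣r (admissible-shift {W = W} (t * p) adm))
           (diagonal-cong eq))
    where
    eq : ∀ i → W (i + p + t * p) ≡ W (i + (p + t * p))
    eq i = cong W (ℕ.+-assoc i p (t * p))

  spread-periodic : ∀ {p W} → suc p ∣ suc s → Admissible (suc p) (suc l) W → HasPeriod (suc p) (spread W W)
  spread-periodic {p} {W} p∣r adm@(per , _) =
    trans (iterate-rotate p∣r adm (suc p)) (diagonal-cong eq)
    where
    eq : ∀ i → W (i + suc p * p) ≡ W i
    eq i = trans (cong (λ z → W (i + z)) (ℕ.*-comm (suc p) p)) (periodic-* {W = W} per p i)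

  periodic-spread : ∀ {p x} → suc p ∣ suc s → HasPeriod (suc p) x →
                    ∃ λ W → Admissible (suc p) (suc l) W × spread W W ≡ x
  periodic-spread {p} {x} (divides k s≡) x-per with spread-surjective x
  ... | α₀ , β₀ , α₀≡β₀ , refl = W , (W-periodic , W-adjacent) , spread-cong left right
    where
    open Trajectory α₀ β₀ α₀≡β₀
    open Iteration (≡-dec _≟ᵇ_) F using (period-*)
    σ-periodic : Periodic (suc p) σ
    σ-periodic t = cong head (begin
      spread (α (t + suc p)) (β (t + suc p))     ≡⟨ iterate-spread (t + suc p) ⟨
      iterate F (t + suc p) (spread α₀ β₀)       ≡⟨ iterate-+ t (suc p) (spread α₀ β₀) ⟩
      iterate F t (iterate F (suc p) (spread α₀ β₀)) ≡⟨ cong (iterate F t) x-per ⟩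
      iterate F t (spread α₀ β₀)                 ≡⟨ iterate-spread t ⟩
      spread (α t) (β t)                         ∎)
      where open ≡-Reasoning
    σ-adjacent : ∀ t → σ t ∨ σ (t + suc l) ≡ true
    σ-adjacent t = fixed (σ t) (σ (t + suc l)) (trans (sym (drop-r (t + suc l)))
      (trans (σ-recurrence t) (cong (λ a → not a ∨ σ (t + suc l)) (drop-r t))))
      where
      drop-r : ∀ t → σ (t + suc s) ≡ σ t
      drop-r t = trans (cong (λ z → σ (t + z)) s≡) (periodic-* {W = σ} σ-periodic k t)
      fixed : ∀ a b → b ≡ not a ∨ b → a ∨ b ≡ true
      fixed true  b eq = refl
      fixed false b eq = eq
    -- p ≡ -1 modulo the period, so W d is the state of node 0 at time -d.
    W : ℕ → Bool
    W d = σ (p * d)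
    W-periodic : Periodic (suc p) W
    W-periodic i = periodic-≡ {W = σ} σ-periodic 0 p (rearrange p i)
      where
      rearrange : ∀ p i → p * (i + suc p) + 0 ≡ p * i + p * suc p
      rearrange = solve-∀
    W-adjacent : ∀ i → W i ∨ W (i + suc l) ≡ true
    W-adjacent i = trans (∨-comm (W i) (W (i + suc l)))
      (trans (cong (W (i + suc l) ∨_) (sym (periodic-≡ {W = σ} σ-periodic 0 (suc l) (rearrange p i l))))
             (σ-adjacent (p * (i + suc l))))
      where
      rearrange : ∀ p i l → p * (i + suc l) + suc l + 0 ≡ p * i + suc l * suc p
      rearrange = solve-∀
    still : ∀ d → spread (α (d + p * d)) (β (d + p * d)) ≡ spread α₀ β₀
    still d = trans (sym (iterate-spread (suc p * d)))
      (trans (cong (λ z → iterate F z (spread α₀ β₀)) (ℕ.*-comm (suc p) d)) (period-* d x-per))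
    left : ∀ {d} → d ≤ l → W d ≡ α₀ d
    left {d} d≤l = trans (sym (α-depth d (p * d)))
      (proj₁ (spread-injective {α (d + p * d)} {β (d + p * d)} {α₀} {β₀} (α≡β (d + p * d)) α₀≡β₀ (still d)) d≤l)
    right : ∀ {d} → d ≤ s → W d ≡ β₀ d
    right {d} d≤s = trans (sym (β-depth d (p * d)))
      (proj₂ (spread-injective {α (d + p * d)} {β (d + p * d)} {α₀} {β₀} (α≡β (d + p * d)) α₀≡β₀ (still d)) d≤s)

  periodic-enumeration : ∀ p .{{_ : NonZero p}} → p ∣ suc s →
    Enumeration (setoid Config) (HasPeriod p)
                (L ((p / gcd (suc l) p) {{gcd-nonZero (suc l) p}}) ^ gcd (suc l) p)
  periodic-enumeration (suc p) p∣r = transport (λ W → spread W W)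
    diagonal-cong
    (λ {W} → spread-periodic {W = W} p∣r)
    (λ {W} {V} (per , _) (per′ , _) eq i → trans (sym (periodic-% {W = W} per i))
      (trans (proj₂ (spread-injective {W} {W} {V} {V} refl refl eq)
                    (ℕ.≤-trans (ℕ.≤-pred (m%n<n i (suc p))) (ℕ.≤-pred (∣⇒≤ p∣r))))
             (periodic-% {W = V} per′ i)))
    (periodic-spread p∣r)
    (admissible-enumeration (suc l) (suc p))

/1-cancel-* : ∀ A p .{{_ : NonZero p}} → (+ A) ℚ./ 1 ≡ (+ 1 ℚ./ p) ℚ.* (+ (A * p) ℚ./ 1)
/1-cancel-* A p@(suc _) = ℚ.toℚᵘ-injective (begin-equality
  toℚᵘ (+ A ℚ./ 1)                             ≃⟨ ℚ.toℚᵘ-fromℚᵘ (+ A ℚᵘ./ 1) ⟩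
  + A ℚᵘ./ 1                                   ≃⟨ *≡* cross ⟩
  (+ 1 ℚᵘ./ p) ℚᵘ.* (+ (A * p) ℚᵘ./ 1)         ≃⟨ ℚᵘ.*-cong (ℚ.toℚᵘ-fromℚᵘ (+ 1 ℚᵘ./ p)) (ℚ.toℚᵘ-fromℚᵘ (+ (A * p) ℚᵘ./ 1)) ⟨
  toℚᵘ (+ 1 ℚ./ p) ℚᵘ.* toℚᵘ (+ (A * p) ℚ./ 1) ≃⟨ ℚ.toℚᵘ-homo-* (+ 1 ℚ./ p) (+ (A * p) ℚ./ 1) ⟨
  toℚᵘ ((+ 1 ℚ./ p) ℚ.* (+ (A * p) ℚ./ 1))     ∎)
  where
  open ℚᵘ.≤-Reasoning
  cross : + A ℤ.* + (p * 1) ≡ (+ 1 ℤ.* + (A * p)) ℤ.* + 1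
  cross = trans (sym (ℤ.pos-* A (p * 1))) (trans (cong (λ z → + (A * z)) (ℕ.*-identityʳ p))
    (sym (trans (ℤ.*-identityʳ (+ 1 ℤ.* + (A * p))) (ℤ.*-identityˡ (+ (A * p))))))

proposition3 : (ℓ r p : ℕ) .{{_ : NonZero ℓ}} .{{_ : NonZero r}} .{{_ : NonZero p}} →
    p ∣ r → p ∤ ℓ →
    let open DoubleCircuit ℓ r in
    NumberOfConfigsOfPeriod p (L ((p / gcd ℓ p) {{gcd-nonZero ℓ p}}) ^ gcd ℓ p) ×
    (∃ λ A → NumberOfAttractorsOfPeriod p A ×
    (+ A) ℚ./ 1 ≡
    (+ 1 ℚ./ p) ℚ.*
    (divisorSum p (λ q →
    μ (p / q) ℤ.* + (L ((q / gcd ℓ q) {{gcd-nonZero ℓ q}}) ^ gcd ℓ q)) ℚ./ 1))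
proposition3 (suc l) (suc s) p p∣r _ =
  let k , exact , k≡ = exact-count (proj₂ (all-Vec _)) _ (λ q q∣p → periodic-enumeration l s q (∣-trans q∣p p∣r))
      A , attr       = attractors exact
  in hasSize (periodic-enumeration l s p p∣r) , A , hasSize attr ,
     trans (/1-cancel-* A p) (cong (λ z → (+ 1 ℚ./ p) ℚ.* (z ℚ./ 1))
       (trans (cong +_ (size-unique (exact-attractors attr) exact)) k≡))
  where
  open DoubleCircuit (suc l) (suc s) using (F)
  open Iteration (≡-dec _≟ᵇ_) F using (exact-count; attractors; exact-attractors)
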